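{- Let $n\ge1$. (a) Any digital $n$-sphere is a digital $n$-manifold. (b) Let $S$ be a digital $n$-sphere and $v$ be a point of $S$. Then $S-v$, obtained from $S$ by deleting the point $v$, is a digital $n$-disk.
   Context: A digital space is a finite simple undirected graph, its vertices are called points; a subspace is an induced subgraph. For a point $v$, the rim $O(v)$ is the subspace induced on the neighbours of $v$; $O(v,u)=O(v)\cap O(u)$. The family $T$ of contractible graphs is defined inductively: the one-point graph $K(1)$ belongs to $T$, and $T$ consists of all graphs obtained from $K(1)$ by finite sequences of the following contractible transformations: deleting a point $v$ with $O(v)\in T$; adding a new point $v$ so that its rim is an induced subgraph $H\in T$; deleting an edge $(v,u)$ with $O(v,u)\in T$; adding an edge between non-adjacent points $v,u$ with $O(v,u)\in T$. A digital $0$-disk is a single point; a digital $0$-sphere is the graph consisting of two non-adjacent points. A digital $1$-sphere is a connected graph in which the rim of every point is a $0$-sphere; a digital $1$-disk is a $1$-sphere with one point deleted (its boundary is the pair of endpoints, its interior the remaining points). Recursively for $n\ge2$: a digital $n$-disk is a connected contractible graph $D$ that is a disjoint union $D=\partial D\cup\mathrm{Int}D$ of two nonempty subspaces such that the rim (in $D$) of each point of $\partial D$ is a digital $(n-1)$-disk, the rim of each point of $\mathrm{Int}D$ is a digital $(n-1)$-sphere, and the boundary $\partial D$ is a digital $(n-1)$-sphere; a digital $n$-sphere is a graph $D\#C$ obtained from two digital $n$-disks $D,C$ with isomorphic boundaries by identifying each point of $\partial D$ with its counterpart in $\partial C$. A digital $n$-manifold is a connected graph in which the rim of every point is a digital $(n-1)$-sphere.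 -}

module Defs where

open import Data.Bool.Base using (Bool; true; false; _∧_; _∨_; not)
open import Data.Bool.Properties using (∧-comm; ∨-comm)
open import Data.Fin.Base using (Fin; zero; suc)
open import Data.Fin.Properties using (_≟_)
open import Data.Fin.Subset using (Subset; inside; outside; _∈_; ∁; ⁅_⁆; _∩_; ∣_∣; Nonempty; ⊥)
open import Data.Nat.Base using (ℕ; zero; suc)
open import Data.Product.Base using (Σ; ∃; ∃₂; _×_; _,_)
open import Data.Sum.Base using (_⊎_)
open import Data.Vec.Base using ([]; _∷_; lookup; tabulate)
open import Function.Bundles using (_↔_; _⇔_; Inverse)
open import Function.Definitions using (Injective)
open import Relation.Binary.Construct.Closure.ReflexiveTransitive using (Star)
open import Relation.Binary.PropositionalEquality
  using (_≡_; _≢_; refl; sym; trans; cong; cong₂)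
open import Relation.Nullary using (¬_; yes; no; does; contradiction)

-- Finite simple undirected graphs, with points labelled by Fin order.  Labels
-- carry no meaning: the notions below are closed under isomorphism.

record Graph : Set where
  field
    order      : ℕ
    adj        : Fin order → Fin order → Bool
    adj-sym    : ∀ x y → adj x y ≡ adj y x
    adj-irrefl : ∀ x → adj x x ≡ false

open Graph public

Point : Graph → Set
Point G = Fin (order G)

Adj : (G : Graph) → Point G → Point G → Set
Adj G x y = adj G x y ≡ true

-- A connected graph is required to have a point.  Otherwise the empty graph
-- would vacuously be a 1-sphere and a manifold of every dimension.

Connected : Graph → Set
Connected G = Point G × (∀ x y → Star (Adj G) x y)

record _≅_ (G H : Graph) : Set where
  field
    bij      : Point G ↔ Point H
    adj-pres : ∀ x y → adj H (Inverse.to bij x) (Inverse.to bij y) ≡ adj G x y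

  to : Point G → Point H
  to = Inverse.to bij

infix 4 _≅_

discrete : ℕ → Graph
discrete n = record
  { order      = n
  ; adj        = λ _ _ → false
  ; adj-sym    = λ _ _ → refl
  ; adj-irrefl = λ _ → refl
  }

K₁ S⁰ : Graph
K₁ = discrete 1
S⁰ = discrete 2

-- The order-preserving enumeration of a subset.

element : ∀ {n} (p : Subset n) → Fin ∣ p ∣ → Fin n
element (inside  ∷ p) zero    = zero
element (inside  ∷ p) (suc i) = suc (element p i)
element (outside ∷ p) i       = suc (element p i)

-- The subspace induced on a set of points, relabelled by Fin ∣ p ∣.

infixl 8 _[_]

_[_] : (G : Graph) → Subset (order G) → Graph
G [ p ] = record
  { order      = ∣ p ∣
  ; adj        = λ i j → adj G (element p i) (element p j)
  ; adj-sym    = λ i j → adj-sym G (element p i) (element p j)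
  ; adj-irrefl = λ i → adj-irrefl G (element p i)
  }

neighbours : (G : Graph) → Point G → Subset (order G)
neighbours G v = tabulate (adj G v)

rim : (G : Graph) → Point G → Graph
rim G v = G [ neighbours G v ]

rim₂ : (G : Graph) → Point G → Point G → Graph
rim₂ G v u = G [ neighbours G v ∩ neighbours G u ]

infixl 7 _-_

_-_ : (G : Graph) → Point G → Graph
G - v = G [ ∁ ⁅ v ⁆ ]

-- The new point is zero, and its rim is G [ p ].

addPoint : (G : Graph) → Subset (order G) → Graph
addPoint G p = record
  { order      = suc (order G)
  ; adj        = a
  ; adj-sym    = a-sym
  ; adj-irrefl = a-irrefl
  }
  where
  a : Fin (suc (order G)) → Fin (suc (order G)) → Bool
  a zero    zero    = false
  a zero    (suc y) = lookup p y
  a (suc x) zero    = lookup p x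
  a (suc x) (suc y) = adj G x y

  a-sym : ∀ x y → a x y ≡ a y x
  a-sym zero    zero    = refl
  a-sym zero    (suc y) = refl
  a-sym (suc x) zero    = refl
  a-sym (suc x) (suc y) = adj-sym G x y

  a-irrefl : ∀ x → a x x ≡ false
  a-irrefl zero    = refl
  a-irrefl (suc x) = adj-irrefl G x

-- Decides {x , y} = {v , u}.

isPair : ∀ {n} (v u x y : Fin n) → Bool
isPair v u x y = (does (x ≟ v) ∧ does (y ≟ u)) ∨ (does (x ≟ u) ∧ does (y ≟ v))

isPair-sym : ∀ {n} (v u x y : Fin n) → isPair v u x y ≡ isPair v u y x
isPair-sym v u x y = trans
  (∨-comm (does (x ≟ v) ∧ does (y ≟ u)) (does (x ≟ u) ∧ does (y ≟ v)))
  (cong₂ _∨_ (∧-comm (does (x ≟ u)) (does (y ≟ v)))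
             (∧-comm (does (x ≟ v)) (does (y ≟ u))))

isPair-irrefl : ∀ {n} {v u : Fin n} → v ≢ u → ∀ x → isPair v u x x ≡ false
isPair-irrefl {v = v} {u} v≢u x with x ≟ v | x ≟ u
... | yes x≡v | yes x≡u = contradiction (trans (sym x≡v) x≡u) v≢u
... | yes _   | no  _   = refl
... | no  _   | yes _   = refl
... | no  _   | no  _   = refl

deleteEdge : (G : Graph) → Point G → Point G → Graph
deleteEdge G v u = record
  { order      = order G
  ; adj        = λ x y → adj G x y ∧ not (isPair v u x y)
  ; adj-sym    = λ x y → cong₂ (λ a b → a ∧ not b) (adj-sym G x y) (isPair-sym v u x y)
  ; adj-irrefl = λ x → cong (_∧ not (isPair v u x x)) (adj-irrefl G x)
  }

addEdge : (G : Graph) (v u : Point G) → v ≢ u → Graph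
addEdge G v u v≢u = record
  { order      = order G
  ; adj        = λ x y → adj G x y ∨ isPair v u x y
  ; adj-sym    = λ x y → cong₂ _∨_ (adj-sym G x y) (isPair-sym v u x y)
  ; adj-irrefl = λ x → cong₂ _∨_ (adj-irrefl G x) (isPair-irrefl v≢u x)
  }

-- The family T.

data Contractible : Graph → Set where
  one-point    : Contractible K₁
  relabel      : ∀ {G H} → G ≅ H → Contractible G → Contractible H
  delete-point : ∀ {G} → Contractible G →
                 ∀ v → Contractible (rim G v) → Contractible (G - v)
  add-point    : ∀ {G} → Contractible G →
                 ∀ p → Contractible (G [ p ]) → Contractible (addPoint G p)
  delete-edge  : ∀ {G} → Contractible G →
                 ∀ v u → Adj G v u → Contractible (rim₂ G v u) →
                 Contractible (deleteEdge G v u)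
  add-edge     : ∀ {G} → Contractible G →
                 ∀ v u (v≢u : v ≢ u) → ¬ Adj G v u → Contractible (rim₂ G v u) →
                 Contractible (addEdge G v u v≢u)

-- G is D # C: the quotient of the disjoint union of D and C identifying each
-- point of ∂D with its image under φ.

record IsGluing (D C : Graph) (∂D : Subset (order D)) (∂C : Subset (order C))
                (φ : D [ ∂D ] ≅ C [ ∂C ]) (G : Graph) : Set where
  field
    inl        : Point D → Point G
    inr        : Point C → Point G
    inl-inj    : Injective _≡_ _≡_ inl
    inr-inj    : Injective _≡_ _≡_ inr
    covering   : ∀ p → (∃ λ x → inl x ≡ p) ⊎ (∃ λ y → inr y ≡ p)
    identified : ∀ x y → inl x ≡ inr y ⇔
                 (∃ λ b → x ≡ element ∂D b × y ≡ element ∂C (_≅_.to φ b))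
    adjacent   : ∀ p q → Adj G p q ⇔
                 ((∃₂ λ x x′ → inl x ≡ p × inl x′ ≡ q × Adj D x x′) ⊎
                  (∃₂ λ y y′ → inr y ≡ p × inr y′ ≡ q × Adj C y y′))

-- IsDiskWithBoundary n D ∂: D is a digital n-disk with boundary ∂ and
-- interior ∁ ∂.  The 0-disk is given empty boundary; this is never used.
-- The endpoints of a 1-disk are its points with exactly one neighbour.

data IsSphere : ℕ → Graph → Set

data IsDiskWithBoundary : ℕ → (D : Graph) → Subset (order D) → Set

IsDisk : ℕ → Graph → Set
IsDisk n D = Σ (Subset (order D)) (IsDiskWithBoundary n D)

data IsSphere where
  sphere₀  : ∀ {S} → S ≅ S⁰ → IsSphere 0 S
  sphere₁  : ∀ {S} → Connected S → (∀ v → IsSphere 0 (rim S v)) → IsSphere 1 S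
  sphere₂₊ : ∀ {n S} D C ∂D ∂C →
             IsDiskWithBoundary (suc (suc n)) D ∂D →
             IsDiskWithBoundary (suc (suc n)) C ∂C →
             (φ : D [ ∂D ] ≅ C [ ∂C ]) →
             IsGluing D C ∂D ∂C φ S →
             IsSphere (suc (suc n)) S

data IsDiskWithBoundary where
  disk₀  : ∀ {D} → D ≅ K₁ → IsDiskWithBoundary 0 D ⊥
  disk₁  : ∀ {D ∂} S (v : Point S) → IsSphere 1 S → D ≅ S - v →
           (∀ x → x ∈ ∂ ⇔ ∣ neighbours D x ∣ ≡ 1) →
           IsDiskWithBoundary 1 D ∂
  disk₂₊ : ∀ {n D ∂} → Connected D → Contractible D →
           Nonempty ∂ → Nonempty (∁ ∂) →
           (∀ x → x ∈ ∂ → IsDisk (suc n) (rim D x)) →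
           (∀ x → x ∈ ∁ ∂ → IsSphere (suc n) (rim D x)) →
           IsSphere (suc n) (D [ ∂ ]) →
           IsDiskWithBoundary (suc (suc n)) D ∂

data IsManifold : ℕ → Graph → Set where
  manifold : ∀ {n M} → Connected M → (∀ v → IsSphere n (rim M v)) →
             IsManifold (suc n) M

{-# OPTIONS --safe #-}

-- (a) If S = D # C and x lies in ∂D, then the rim of x in S is the gluing of its
-- rims in D and in C, provided that the boundary of the disk rim D x is the rim
-- of x in ∂D.  That boundary lies in ∂D, because a point y of it outside ∂D would
-- make rim D x ∩ rim D y both a disk and a sphere; it is then the whole rim of x
-- in ∂D, because both are spheres of the same dimension.
--
-- (b) The point is that S - v is contractible.  For adjacent u and w both S - u and
-- S - w reduce to S - u - w, as the rims to be removed are punctured spheres of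
-- lower dimension; so it suffices to treat one point v of S.  Capping D with a cone
-- over ∂D gives a sphere which becomes D when the apex is deleted, so the capped
-- disk punctured at an interior point v of D is contractible, and it is equivalent
-- to S - v since C can be contracted to the cone point.

module Submission where

open import Defs
open import Data.Bool.Base using (Bool; true; false)
open import Data.Bool.Properties using () renaming (_≟_ to _≟ᵇ_)
open import Data.Empty using () renaming (⊥-elim to absurd)
open import Data.Fin.Base using (Fin; zero; suc)
open import Data.Fin.Properties using (_≟_; any?; suc-injective)
open import Data.Fin.Permutation using (↔⇒≡)
open import Data.Fin.Subset
  using (Subset; inside; outside; _∈_; _∉_; ∁; ⁅_⁆; _∪_; ∣_∣; Nonempty; ⊥; ⊤; _⊃_)
open import Data.Fin.Subset.Induction using (⊃-wellFounded; Acc; acc)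
open import Data.Fin.Subset.Properties
  using (_∈?_; ∈⊤; ∉⊥; x∈⁅x⁆; x∈⁅y⁆⇒x≡y; x∈∁p⇒x∉p; x∉p⇒x∈∁p; x∈p∪q⁻; x∈p∪q⁺)
open import Data.List.Base using (List; []; _∷_; filter; length; allFin)
open import Data.List.Membership.Propositional using () renaming (_∈_ to _∈ˡ_)
open import Data.List.Membership.Propositional.Properties using (∈-filter⁺; ∈-filter⁻; ∈-allFin)
open import Data.List.Membership.DecPropositional using () renaming (_∈?_ to member?)
open import Data.List.Properties using (length-filter)
open import Data.List.Relation.Unary.Any using (here; there)
open import Data.Nat.Base using (ℕ; zero; suc; _≤_; s≤s)
open import Data.Nat.Properties using (≤-trans; ≤-refl) renaming (_≟_ to _≟ⁿ_)
open import Data.Product.Base using (Σ; ∃; ∃₂; _×_; _,_; proj₁; proj₂; map₂)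
open import Data.Sum.Base using (_⊎_; inj₁; inj₂; [_,_]′; swap)
open import Data.Unit.Base using (tt) renaming (⊤ to Unit)
open import Data.Vec.Base using (_∷_; lookup; tabulate; here; there)
open import Data.Vec.Properties using (lookup⇒[]=; []=⇒lookup; lookup∘tabulate)
open import Function.Base using (_∘_; id)
open import Function.Bundles using (_⇔_; mk⇔; mk↔ₛ′; Inverse; Equivalence)
open import Relation.Binary.Construct.Closure.ReflexiveTransitive
  using (Star; ε; _◅_; _◅◅_; gmap; reverse)
open import Relation.Binary.PropositionalEquality
  using (_≡_; _≢_; refl; sym; trans; cong; cong₂; subst; subst₂)
open import Relation.Nullary using (¬_; Dec; yes; no; does; contradiction; ¬?; _×-dec_)
open import Relation.Nullary.Decidable using (map′; dec-true; decidable-stable)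
open import Relation.Unary using (Decidable)

private
  variable
    X Y G : Graph

-- Subsets, their enumerations, and adjacency.

∈-tabulate⁺ : ∀ {n} {f : Fin n → Bool} {x} → f x ≡ true → x ∈ tabulate f
∈-tabulate⁺ {f = f} {x} eq = lookup⇒[]= x (tabulate f) (trans (lookup∘tabulate f x) eq)

∈-tabulate⁻ : ∀ {n} {f : Fin n → Bool} {x} → x ∈ tabulate f → f x ≡ true
∈-tabulate⁻ {f = f} {x} x∈ = trans (sym (lookup∘tabulate f x)) ([]=⇒lookup x∈)

does⁻ : ∀ {A : Set} (a? : Dec A) → does a? ≡ true → A
does⁻ (yes a) _ = a

select : ∀ {n} {P : Fin n → Set} → Decidable P → Subset n
select P? = tabulate (does ∘ P?)

∈-select⁺ : ∀ {n} {P : Fin n → Set} (P? : Decidable P) {x} → P x → x ∈ select P?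
∈-select⁺ P? {x} px = ∈-tabulate⁺ (dec-true (P? x) px)

∈-select⁻ : ∀ {n} {P : Fin n → Set} (P? : Decidable P) {x} → x ∈ select P? → P x
∈-select⁻ P? {x} x∈ = does⁻ (P? x) (∈-tabulate⁻ x∈)

element-∈ : ∀ {n} (p : Subset n) i → element p i ∈ p
element-∈ (inside  ∷ p) zero    = here
element-∈ (inside  ∷ p) (suc i) = there (element-∈ p i)
element-∈ (outside ∷ p) i       = there (element-∈ p i)

element-injective : ∀ {n} (p : Subset n) {i j} → element p i ≡ element p j → i ≡ j
element-injective (inside  ∷ p) {zero}  {zero}  _  = refl
element-injective (inside  ∷ p) {suc i} {suc j} eq =
  cong suc (element-injective p (suc-injective eq))
element-injective (outside ∷ p) eq = element-injective p (suc-injective eq)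

index : ∀ {n} (p : Subset n) {x} → x ∈ p → ∃ λ i → element p i ≡ x
index (inside  ∷ p) here       = zero , refl
index (inside  ∷ p) (there x∈) = let i , eq = index p x∈ in suc i , cong suc eq
index (outside ∷ p) (there x∈) = let i , eq = index p x∈ in i , cong suc eq

adj? : ∀ G (x y : Point G) → Dec (Adj G x y)
adj? G x y = adj G x y ≟ᵇ true

Adj-sym : ∀ G {x y} → Adj G x y → Adj G y x
Adj-sym G {x} {y} a = trans (adj-sym G y x) a

Adj-irrefl : ∀ G {x} → ¬ Adj G x x
Adj-irrefl G {x} a with trans (sym a) (adj-irrefl G x)
... | ()

Adj⇒≢ : ∀ G {x y} → Adj G x y → x ≢ y
Adj⇒≢ G a refl = Adj-irrefl G a

⇔⇒≡ : ∀ {a b : Bool} → (a ≡ true → b ≡ true) → (b ≡ true → a ≡ true) → a ≡ b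
⇔⇒≡ {true}          f g = sym (f refl)
⇔⇒≡ {false} {true}  f g = g refl
⇔⇒≡ {false} {false} f g = refl

-- Copies of predicates in an ambient graph.

-- Isomorphisms between subspaces are all obtained by comparing copies of the
-- same predicate in one ambient graph (copy-≅).

record Copy (X G : Graph) (P : Point G → Set) : Set where
  field
    at       : Point X → Point G
    at-inj   : ∀ {x y} → at x ≡ at y → x ≡ y
    at-adj   : ∀ x y → adj G (at x) (at y) ≡ adj X x y
    sound    : ∀ x → P (at x)
    complete : ∀ {g} → P g → ∃ λ x → at x ≡ g

  Adj⁺ : ∀ {x y} → Adj X x y → Adj G (at x) (at y)
  Adj⁺ {x} {y} a = trans (at-adj x y) a

  Adj⁻ : ∀ {x y} → Adj G (at x) (at y) → Adj X x y
  Adj⁻ {x} {y} a = trans (sym (at-adj x y)) a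

open Copy

copy-resp : ∀ {P Q : Point G → Set} → (∀ {g} → P g → Q g) → (∀ {g} → Q g → P g) →
            Copy X G P → Copy X G Q
copy-resp P⊆Q Q⊆P c = record
  { at = at c ; at-inj = at-inj c ; at-adj = at-adj c
  ; sound = P⊆Q ∘ sound c ; complete = complete c ∘ Q⊆P }

-- Search over the finite graph `X` decides membership, so predicates may be arbitrary types with no
-- decidability hypothesis carried along.
copy-dec : ∀ {P : Point G → Set} → Copy X G P → Decidable P
copy-dec {P = P} c g = map′ (λ (x , eq) → subst P eq (sound c x)) (complete c)
                            (any? (λ x → at c x ≟ g))

copy-id : Copy G G (λ _ → Unit)
copy-id = record
  { at = id ; at-inj = id ; at-adj = λ _ _ → refl ; sound = λ _ → tt ; complete = λ {g} _ → g , refl }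

copy-∘ : ∀ {P Q : Point G → Set} (d : Copy Y G Q) → Copy X Y (P ∘ at d) →
         Copy X G (λ g → Q g × P g)
copy-∘ {P = P} d c = record
  { at       = at d ∘ at c
  ; at-inj   = at-inj c ∘ at-inj d
  ; at-adj   = λ x y → trans (at-adj d _ _) (at-adj c x y)
  ; sound    = λ x → sound d (at c x) , sound c x
  ; complete = λ (q , p) →
      let y , dy≡g = complete d q
          x , cx≡y = complete c (subst P (sym dy≡g) p)
      in x , trans (cong (at d) cx≡y) dy≡g
  }

-- Every point of `c` lifts through `d`, and as both copies are induced in `G`, so is the lift. This
-- moves statements from the ambient graph into a subspace of it.
copy-factor : ∀ {P Q : Point G → Set} → Copy X G P → (d : Copy Y G Q) →
              (∀ {g} → P g → Q g) → Copy X Y (P ∘ at d)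
copy-factor {G = G} {P = P} c d P⊆Q = record
  { at       = f
  ; at-inj   = λ {x} {y} eq → at-inj c (trans (sym (law x)) (trans (cong (at d) eq) (law y)))
  ; at-adj   = λ x y → trans (sym (at-adj d _ _))
                             (trans (cong₂ (adj G) (law x) (law y)) (at-adj c x y))
  ; sound    = λ x → subst P (sym (law x)) (sound c x)
  ; complete = λ p → let x , eq = complete c p in x , at-inj d (trans (law x) eq)
  }
  where
  f   = λ x → proj₁ (complete d (P⊆Q (sound c x)))
  law = λ x → proj₂ (complete d (P⊆Q (sound c x)))

copy-factor-at : ∀ {P Q : Point G → Set} (c : Copy X G P) (d : Copy Y G Q)
                 (P⊆Q : ∀ {g} → P g → Q g) →
                 ∀ x → at d (at (copy-factor c d P⊆Q) x) ≡ at c x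
copy-factor-at c d P⊆Q x = proj₂ (complete d (P⊆Q (sound c x)))

-- Each copy factors through the other, and injectivity into the common ambient graph makes the two
-- factorings inverse.
copy-≅ : ∀ {P : Point G → Set} → Copy X G P → Copy Y G P → X ≅ Y
copy-≅ c d = record
  { bij      = mk↔ₛ′ (at c→d) (at d→c)
                 (λ y → at-inj d (trans (copy-factor-at c d id _) (copy-factor-at d c id y)))
                 (λ x → at-inj c (trans (copy-factor-at d c id _) (copy-factor-at c d id x)))
  ; adj-pres = at-adj c→d }
  where
  c→d = copy-factor c d id
  d→c = copy-factor d c id

≅⇒copy : X ≅ Y → Copy X Y (λ _ → Unit)
≅⇒copy φ = record
  { at       = Inverse.to bij
  ; at-inj   = λ {x} {y} eq → trans (sym (Inverse.strictlyInverseʳ bij x))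
                 (trans (cong (Inverse.from bij) eq) (Inverse.strictlyInverseʳ bij y))
  ; at-adj   = _≅_.adj-pres φ
  ; sound    = λ _ → tt
  ; complete = λ {y} _ → Inverse.from bij y , Inverse.strictlyInverseˡ bij y
  }
  where open _≅_ φ using (bij)

≅-sym : X ≅ Y → Y ≅ X
≅-sym φ = copy-≅ copy-id (≅⇒copy φ)

≅-refl : X ≅ X
≅-refl = copy-≅ copy-id copy-id

≅-along : ∀ {P} → Copy X G P → X ≅ Y → Copy Y G P
≅-along c φ = copy-resp proj₁ (_, tt) (copy-∘ {P = λ _ → Unit} c (≅⇒copy (≅-sym φ)))

≅-trans : ∀ {Z} → X ≅ Y → Y ≅ Z → X ≅ Z
≅-trans φ ψ = copy-≅ (copy-resp _ _ (copy-∘ {P = λ _ → Unit} (≅⇒copy ψ) (≅⇒copy φ))) copy-id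

copy-sub : ∀ G p → Copy (G [ p ]) G (_∈ p)
copy-sub G p = record
  { at       = element p
  ; at-inj   = element-injective p
  ; at-adj   = λ _ _ → refl
  ; sound    = element-∈ p
  ; complete = index p
  }

copy-rim : ∀ G v → Copy (rim G v) G (Adj G v)
copy-rim G v = copy-resp ∈-tabulate⁻ ∈-tabulate⁺ (copy-sub G (neighbours G v))

copy-delete : ∀ G v → Copy (G - v) G (_≢ v)
copy-delete G v = copy-resp
  (λ {g} g∈ g≡v → x∈∁p⇒x∉p g∈ (subst (_∈ ⁅ v ⁆) (sym g≡v) (x∈⁅x⁆ v)))
  (λ g≢v → x∉p⇒x∈∁p (g≢v ∘ x∈⁅y⁆⇒x≡y v))
  (copy-sub G (∁ ⁅ v ⁆))

module _ {P : Point G → Set} (c : Copy X G P) where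

  copy-∘-sub : ∀ p {Q : Point G → Set} → (∀ {x} → x ∈ p → Q (at c x)) → (∀ {x} → Q (at c x) → x ∈ p) →
               Copy (X [ p ]) G (λ g → P g × Q g)
  copy-∘-sub p {Q} p⇒Q Q⇒p = copy-∘ {P = Q} c (copy-resp p⇒Q Q⇒p (copy-sub X p))

  copy-∘-rim : ∀ x → Copy (rim X x) G (λ g → P g × Adj G (at c x) g)
  copy-∘-rim x = copy-∘ {P = Adj G (at c x)} c (copy-resp (Adj⁺ c) (Adj⁻ c) (copy-rim X x))

  copy-∘-delete : ∀ x → Copy (X - x) G (λ g → P g × g ≢ at c x)
  copy-∘-delete x = copy-∘ {P = _≢ at c x} c
    (copy-resp (λ ≢x eq → ≢x (at-inj c eq)) (λ ≢x eq → ≢x (cong (at c) eq)) (copy-delete X x))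

-- Contractible subspaces

-- The labelled graph is existential, so relabellings need not be tracked: `relabel` passes
-- contractibility to every other copy of `P`.
Con : (G : Graph) → (Point G → Set) → Set
Con G P = ∃ λ X → Copy X G P × Contractible X

con⇒contractible : ∀ {P : Point G → Set} → Con G P → Copy X G P → Contractible X
con⇒contractible (_ , c , t) d = relabel (copy-≅ c d) t

con-resp : ∀ {P Q : Point G → Set} → (∀ {g} → P g → Q g) → (∀ {g} → Q g → P g) →
           Con G P → Con G Q
con-resp P⊆Q Q⊆P (X , c , t) = X , copy-resp P⊆Q Q⊆P c , t

-- The transformation `add-point` performed inside `G`: the new point is an actual point `x`, so its
-- rim is cut out by adjacency in `G`.
con-add : ∀ {P : Point G → Set} {x} → Con G P → ¬ P x → Con G (λ g → P g × Adj G x g) →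
          Con G (λ g → P g ⊎ g ≡ x)
con-add {G = G} {P} {x} (X , c , t) ¬Px r = addPoint X p , d ,
  add-point t p (con⇒contractible r (copy-∘-sub c p (∈-select⁻ near?) (∈-select⁺ near?)))
  where
  near? : Decidable (λ i → Adj G x (at c i))
  near? i = adj? G x (at c i)

  p = select near?

  f : Point (addPoint X p) → Point G
  f zero    = x
  f (suc i) = at c i

  lookup-p : ∀ i → adj G x (at c i) ≡ lookup p i
  lookup-p i = ⇔⇒≡ (λ a → []=⇒lookup (∈-select⁺ near? a))
                   (λ e → ∈-select⁻ near? (lookup⇒[]= i p e))

  d : Copy (addPoint X p) G (λ g → P g ⊎ g ≡ x)
  at       d = f
  at-inj   d {zero}  {zero}  _  = refl
  at-inj   d {zero}  {suc j} eq = contradiction (subst P (sym eq) (sound c j)) ¬Px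
  at-inj   d {suc i} {zero}  eq = contradiction (subst P eq (sound c i)) ¬Px
  at-inj   d {suc i} {suc j} eq = cong suc (at-inj c eq)
  at-adj   d zero    zero    = adj-irrefl G x
  at-adj   d zero    (suc j) = lookup-p j
  at-adj   d (suc i) zero    = trans (adj-sym G (at c i) x) (lookup-p i)
  at-adj   d (suc i) (suc j) = at-adj c i j
  sound    d zero    = inj₂ refl
  sound    d (suc i) = inj₁ (sound c i)
  complete d (inj₁ Pg)  = let i , eq = complete c Pg in suc i , eq
  complete d (inj₂ g≡x) = zero , sym g≡x

con-delete : ∀ {P : Point G → Set} {x} → Con G P → P x → Con G (λ g → P g × Adj G x g) →
             Con G (λ g → P g × g ≢ x)
con-delete (X , c , t) Px r with complete c Px
... | i , refl = X - i , copy-∘-delete c i ,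
                 delete-point t i (con⇒contractible r (copy-∘-rim c i))

con-∘ : ∀ {P Q : Point G → Set} (d : Copy Y G Q) → Con Y (P ∘ at d) → Con G (λ g → Q g × P g)
con-∘ d (X , c , t) = X , copy-∘ d c , t

con-factor : ∀ {P Q : Point G → Set} → Con G P → (d : Copy Y G Q) → (∀ {g} → P g → Q g) →
             Con Y (P ∘ at d)
con-factor (X , c , t) d P⊆Q = X , copy-factor c d P⊆Q , t

con-singleton : ∀ x → Con G (_≡ x)
con-singleton {G = G} x = K₁ , c , one-point
  where
  c : Copy K₁ G (_≡ x)
  at       c _ = x
  at-inj   c {zero} {zero} _ = refl
  at-adj   c _ _ = adj-irrefl G x
  sound    c _ = refl
  complete c g≡x = zero , sym g≡x

-- The cone grows one base point at a time. The rim of a new `y` in the cone built so far is again a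
-- cone with apex `c`, over those `ys` adjacent to `y`, hence contractible by recursion. The
-- filtered list is no subterm, so `k` bounds the length instead.
con-cone-list : ∀ k (c : Point G) ys → length ys ≤ k → (∀ {y} → y ∈ˡ ys → Adj G c y) →
                Con G (λ g → g ≡ c ⊎ g ∈ˡ ys)
con-cone-list k c [] _ _ = con-resp inj₁ [ id , (λ ()) ]′ (con-singleton c)
con-cone-list {G = G} (suc k) c (y ∷ ys) (s≤s ys≤k) near with member? _≟_ y ys
... | yes y∈ys = con-resp [ inj₁ , inj₂ ∘ there ]′
                   [ inj₁ , (λ { (here g≡y) → inj₂ (subst (_∈ˡ ys) (sym g≡y) y∈ys)
                               ; (there g∈) → inj₂ g∈ }) ]′
                   (con-cone-list k c ys ys≤k (near ∘ there))
... | no y∉ys = con-resp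
      [ [ inj₁ , inj₂ ∘ there ]′ , inj₂ ∘ here ]′
      [ inj₁ ∘ inj₁ , (λ { (here g≡y) → inj₂ g≡y ; (there g∈) → inj₁ (inj₂ g∈) }) ]′
      (con-add (con-cone-list k c ys ys≤k (near ∘ there))
        [ (λ y≡c → Adj⇒≢ G (near (here refl)) (sym y≡c)) , y∉ys ]′
        (con-resp
          [ (λ { refl → inj₁ refl , Adj-sym G (near (here refl)) })
          , (λ g∈ → let g∈ys , a = ∈-filter⁻ (adj? G y) {xs = ys} g∈ in inj₂ g∈ys , a) ]′
          (λ { (inj₁ g≡c , _) → inj₁ g≡c
             ; (inj₂ g∈ys , a) → inj₂ (∈-filter⁺ (adj? G y) g∈ys a) })
          (con-cone-list k c (filter (adj? G y) ys)
            (≤-trans (length-filter (adj? G y) ys) ys≤k)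
            (λ g∈ → near (there (proj₁ (∈-filter⁻ (adj? G y) {xs = ys} g∈)))))))

con-cone : ∀ {P : Point G → Set} → Decidable P → ∀ c → P c → (∀ {g} → P g → g ≢ c → Adj G c g) →
           Con G P
con-cone {G = G} {P} P? c Pc near = con-resp
  [ (λ { refl → Pc }) , (λ g∈ → proj₁ (proj₂ (∈-filter⁻ Q? {xs = allFin _} g∈))) ]′ split
  (con-cone-list _ c (filter Q? (allFin _)) ≤-refl
    (λ g∈ → let _ , Pg , g≢c = ∈-filter⁻ Q? {xs = allFin _} g∈ in near Pg g≢c))
  where
  Q? : Decidable (λ g → P g × g ≢ c)
  Q? g = P? g ×-dec ¬? (g ≟ c)

  split : ∀ {g} → P g → g ≡ c ⊎ g ∈ˡ filter Q? (allFin _)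
  split {g} Pg with g ≟ c
  ... | yes g≡c = inj₁ g≡c
  ... | no  g≢c = inj₂ (∈-filter⁺ Q? (∈-allFin g) (Pg , g≢c))

-- A point dominated by c has a cone with apex c as its rim.

con-dominated : ∀ {P Q : Point G → Set} → Con G P → (∀ {g} → P g → Q g) → Decidable Q →
                ∀ c → P c →
                (∀ {y} → Q y → ¬ P y → Adj G c y × (∀ {z} → Q z → Adj G y z → z ≢ c → Adj G c z)) →
                Con G Q
con-dominated {G = G} {P} {Q} con P⊆Q Q? c Pc dom = con-resp
  [ P⊆Q , (λ g∈ → proj₂ (∈-filter⁻ Q? {xs = allFin _} g∈)) ]′
  (λ {g} Qg → inj₂ (∈-filter⁺ Q? (∈-allFin g) Qg))
  (grow (filter Q? (allFin _)) (λ y∈ → proj₂ (∈-filter⁻ Q? {xs = allFin _} y∈)))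
  where
  grow : ∀ ys → (∀ {y} → y ∈ˡ ys → Q y) → Con G (λ g → P g ⊎ g ∈ˡ ys)
  grow [] _ = con-resp inj₁ [ id , (λ ()) ]′ con
  grow (y ∷ ys) ys⊆Q with grow ys (ys⊆Q ∘ there)
  ... | con′@(_ , copy , _) with copy-dec copy y
  ... | yes old = con-resp [ inj₁ , inj₂ ∘ there ]′
                    [ inj₁ , (λ { (here refl) → old ; (there g∈) → inj₂ g∈ }) ]′ con′
  ... | no new = con-resp
      [ [ inj₁ , inj₂ ∘ there ]′ , inj₂ ∘ here ]′
      [ inj₁ ∘ inj₁ , (λ { (here g≡y) → inj₂ g≡y ; (there g∈) → inj₁ (inj₂ g∈) }) ]′
      (con-add con′ new
        (con-cone (λ g → copy-dec copy g ×-dec adj? G y g) c (inj₁ Pc , Adj-sym G c~y)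
          (λ { (old , y~g) g≢c → dom-y ([ P⊆Q , ys⊆Q ∘ there ]′ old) y~g g≢c })))
    where
    c~y   = proj₁ (dom (ys⊆Q (here refl)) (new ∘ inj₁))
    dom-y = proj₂ (dom (ys⊆Q (here refl)) (new ∘ inj₁))

contractible-cone : ∀ K → Contractible (addPoint K ⊤)
contractible-cone K = con⇒contractible
  (con-cone {P = λ _ → Unit} (λ _ → yes tt) zero tt
    (λ { {zero} _ ≢0 → contradiction refl ≢0 ; {suc x} _ _ → []=⇒lookup (∈⊤ {x = x}) }))
  copy-id

-- The 0-sphere and the one-point graph.

other-point : X ≅ S⁰ → ∀ v → ∃ λ w → w ≢ v × (∀ x → x ≡ v ⊎ x ≡ w)
other-point {X = X} φ v = from′ (other (at c v))
  where
  c : Copy X S⁰ (λ _ → Unit)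
  c = ≅⇒copy φ

  other : (i : Fin 2) → ∃ λ j → j ≢ i × (∀ k → k ≡ i ⊎ k ≡ j)
  other zero       = suc zero , (λ ()) , λ { zero → inj₁ refl ; (suc zero) → inj₂ refl }
  other (suc zero) = zero , (λ ()) , λ { zero → inj₂ refl ; (suc zero) → inj₁ refl }

  from′ : (∃ λ j → j ≢ at c v × (∀ k → k ≡ at c v ⊎ k ≡ j)) → ∃ λ w → w ≢ v × (∀ x → x ≡ v ⊎ x ≡ w)
  from′ (j , j≢ , only) with complete c {j} tt
  ... | w , refl = w , (λ { refl → j≢ refl }) ,
                   λ x → [ inj₁ ∘ at-inj c , inj₂ ∘ at-inj c ]′ (only (at c x))

S⁰-nonadjacent : X ≅ S⁰ → ∀ {x y} → ¬ Adj X x y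
S⁰-nonadjacent φ a with Adj⁺ (≅⇒copy φ) a
... | ()

two-points⇒S⁰ : ∀ v w → v ≢ w → (∀ x → x ≡ v ⊎ x ≡ w) → ¬ Adj X v w → X ≅ S⁰
two-points⇒S⁰ {X = X} v w v≢w only v≁w = copy-≅ copy-id c
  where
  c : Copy S⁰ X (λ _ → Unit)
  at       c zero       = v
  at       c (suc zero) = w
  at-inj   c {zero}     {zero}     _  = refl
  at-inj   c {zero}     {suc zero} eq = contradiction eq v≢w
  at-inj   c {suc zero} {zero}     eq = contradiction (sym eq) v≢w
  at-inj   c {suc zero} {suc zero} _  = refl
  at-adj   c zero       zero       = adj-irrefl X v
  at-adj   c zero       (suc zero) = ⇔⇒≡ (λ a → contradiction a v≁w) (λ ())
  at-adj   c (suc zero) zero       = ⇔⇒≡ (λ a → contradiction (Adj-sym X a) v≁w) (λ ())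
  at-adj   c (suc zero) (suc zero) = adj-irrefl X w
  sound    c _ = tt
  complete c {g} _ = [ (λ eq → zero , sym eq) , (λ eq → suc zero , sym eq) ]′ (only g)

one-point⇒K₁ : ∀ v → (∀ x → x ≡ v) → X ≅ K₁
one-point⇒K₁ {X = X} v only = copy-≅ copy-id c
  where
  c : Copy K₁ X (λ _ → Unit)
  at       c _ = v
  at-inj   c {zero} {zero} _ = refl
  at-adj   c _ _ = adj-irrefl X v
  sound    c _ = tt
  complete c {g} _ = zero , sym (only g)

K₁-unique : X ≅ K₁ → ∃ λ v → ∀ (x : Point X) → x ≡ v
K₁-unique φ = let v , _ = complete (≅⇒copy φ) {zero} tt
              in v , λ x → at-inj (≅⇒copy φ) (Fin1 _ _)
  where
  Fin1 : (i j : Fin 1) → i ≡ j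
  Fin1 zero zero = refl

Fin≡1 : ∀ {n} → n ≡ 1 → ∃ λ v → ∀ (x : Fin n) → x ≡ v
Fin≡1 refl = zero , λ { zero → refl }

≅⇒order≡ : X ≅ Y → order X ≡ order Y
≅⇒order≡ φ = ↔⇒≡ (_≅_.bij φ)

-- Transport along isomorphisms

rim-≅ : (c : Copy X Y (λ _ → Unit)) → ∀ x → rim X x ≅ rim Y (at c x)
rim-≅ {Y = Y} c x = copy-≅ (copy-resp proj₂ (tt ,_) (copy-∘-rim c x)) (copy-rim Y (at c x))

connected-root : ∀ r → (∀ x → Star (Adj G) r x) → Connected G
connected-root {G = G} r reach = r , λ x y → reverse (Adj-sym G) (reach x) ◅◅ reach y

connected-≅ : Copy X Y (λ _ → Unit) → Connected X → Connected Y
connected-≅ {Y = Y} c (x , path) = connected-root {G = Y} (at c x) λ y →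
  let x′ , eq = complete c tt in subst (Star (Adj Y) _) eq (gmap (at c) (Adj⁺ c) (path x x′))

-- Gluings as covers by two subspaces.

-- A gluing D # C seen inside the glued graph: left and right are the images of
-- D and C, and both boundaries are their intersection.

record Cover (D C : Graph) (∂D : Subset (order D)) (∂C : Subset (order C)) (G : Graph) : Set₁ where
  field
    Left Right : Point G → Set
    left       : Copy D G Left
    right      : Copy C G Right
    covering   : ∀ g → Left g ⊎ Right g
    ∂ˡ⁺        : ∀ {x} → x ∈ ∂D → Right (at left x)
    ∂ˡ⁻        : ∀ {x} → Right (at left x) → x ∈ ∂D
    ∂ʳ⁺        : ∀ {y} → y ∈ ∂C → Left (at right y)
    ∂ʳ⁻        : ∀ {y} → Left (at right y) → y ∈ ∂C
    uncrossed  : ∀ {g h} → Adj G g h → (Left g × Left h) ⊎ (Right g × Right h)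

cover-swap : ∀ {D C ∂D ∂C} → Cover D C ∂D ∂C G → Cover C D ∂C ∂D G
cover-swap κ = record
  { Left = Right ; Right = Left ; left = right ; right = left ; covering = swap ∘ covering
  ; ∂ˡ⁺ = ∂ʳ⁺ ; ∂ˡ⁻ = ∂ʳ⁻ ; ∂ʳ⁺ = ∂ˡ⁺ ; ∂ʳ⁻ = ∂ˡ⁻ ; uncrossed = swap ∘ uncrossed }
  where open Cover κ

cover-≅ : ∀ {D C ∂D ∂C} → Copy Y X (λ _ → Unit) → Cover D C ∂D ∂C X → Cover D C ∂D ∂C Y
cover-≅ c κ = record
  { Left      = Left ∘ at c
  ; Right     = Right ∘ at c
  ; left      = copy-factor left c _
  ; right     = copy-factor right c _
  ; covering  = covering ∘ at c
  ; ∂ˡ⁺       = λ x∈ → subst Right (sym (copy-factor-at left c _ _)) (∂ˡ⁺ x∈)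
  ; ∂ˡ⁻       = λ r → ∂ˡ⁻ (subst Right (copy-factor-at left c _ _) r)
  ; ∂ʳ⁺       = λ y∈ → subst Left (sym (copy-factor-at right c _ _)) (∂ʳ⁺ y∈)
  ; ∂ʳ⁻       = λ l → ∂ʳ⁻ (subst Left (copy-factor-at right c _ _) l)
  ; uncrossed = uncrossed ∘ Adj⁺ c
  }
  where open Cover κ

-- The issue is that `D` and `C` stay induced in `G`. An edge of `C` between two points of `D` has
-- both ends identified, and `φ` carries it back to an edge of `D`; the other side is symmetric.
gluing⇒cover : ∀ {D C ∂D ∂C φ} → IsGluing D C ∂D ∂C φ G → Cover D C ∂D ∂C G
gluing⇒cover {G = G} {D} {C} {∂D} {∂C} {φ} γ = record
  { Left      = λ g → ∃ λ x → inl x ≡ g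
  ; Right     = λ g → ∃ λ y → inr y ≡ g
  ; left      = record
    { at = inl ; at-inj = inl-inj ; sound = λ x → x , refl ; complete = id
    ; at-adj = λ x x′ → ⇔⇒≡ (adjˡ x x′)
        (λ a → Equivalence.from (adjacent _ _) (inj₁ (x , x′ , refl , refl , a))) }
  ; right     = record
    { at = inr ; at-inj = inr-inj ; sound = λ y → y , refl ; complete = id
    ; at-adj = λ y y′ → ⇔⇒≡ (adjʳ y y′)
        (λ a → Equivalence.from (adjacent _ _) (inj₂ (y , y′ , refl , refl , a))) }
  ; covering  = covering
  ; ∂ˡ⁺       = λ x∈ → let b , eq = index ∂D x∈ in
                  _ , sym (Equivalence.from (identified _ _) (b , sym eq , refl))
  ; ∂ˡ⁻       = λ (y , eq) → let b , x≡ , _ = Equivalence.to (identified _ _) (sym eq) in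
                  subst (_∈ ∂D) (sym x≡) (element-∈ ∂D b)
  ; ∂ʳ⁺       = λ y∈ → let b′ , eq = index ∂C y∈
                           b , eq′ = complete (≅⇒copy φ) {b′} tt in
                  _ , Equivalence.from (identified _ _)
                        (b , refl , trans (sym eq) (cong (element ∂C) (sym eq′)))
  ; ∂ʳ⁻       = λ (x , eq) → let b , _ , y≡ = Equivalence.to (identified _ _) eq in
                  subst (_∈ ∂C) (sym y≡) (element-∈ ∂C _)
  ; uncrossed = λ a → [ (λ (x , x′ , e , e′ , _) → inj₁ ((x , e) , (x′ , e′)))
                      , (λ (y , y′ , e , e′ , _) → inj₂ ((y , e) , (y′ , e′))) ]′
                      (Equivalence.to (adjacent _ _) a)
  }
  where
  open IsGluing γ

  adjˡ : ∀ x x′ → Adj G (inl x) (inl x′) → Adj D x x′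
  adjˡ x x′ a with Equivalence.to (adjacent _ _) a
  ... | inj₁ (_ , _ , e , e′ , a′) = subst₂ (Adj D) (inl-inj e) (inl-inj e′) a′
  ... | inj₂ (_ , _ , e , e′ , a′)
    with Equivalence.to (identified _ _) (sym e) | Equivalence.to (identified _ _) (sym e′)
  ... | b , refl , refl | b′ , refl , refl = trans (sym (_≅_.adj-pres φ b b′)) a′

  adjʳ : ∀ y y′ → Adj G (inr y) (inr y′) → Adj C y y′
  adjʳ y y′ a with Equivalence.to (adjacent _ _) a
  ... | inj₂ (_ , _ , e , e′ , a′) = subst₂ (Adj C) (inr-inj e) (inr-inj e′) a′
  ... | inj₁ (_ , _ , e , e′ , a′)
    with Equivalence.to (identified _ _) e | Equivalence.to (identified _ _) e′
  ... | b , refl , refl | b′ , refl , refl = trans (_≅_.adj-pres φ b b′) a′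

-- Both boundaries are copies of the intersection of `Left` and `Right`, so `copy-≅` supplies the
-- isomorphism between them.
cover⇒gluing : ∀ {D C ∂D ∂C} → Cover D C ∂D ∂C G →
               Σ (D [ ∂D ] ≅ C [ ∂C ]) λ φ → IsGluing D C ∂D ∂C φ G
cover⇒gluing {G = G} {D} {C} {∂D} {∂C} κ = copy-≅ cD cC , record
  { inl        = at left
  ; inr        = at right
  ; inl-inj    = at-inj left
  ; inr-inj    = at-inj right
  ; covering   = λ g → [ inj₁ ∘ complete left , inj₂ ∘ complete right ]′ (covering g)
  ; identified = λ x y → mk⇔ (shared x y)
      (λ { (b , refl , refl) → sym (copy-factor-at cD cC id b) })
  ; adjacent   = λ g h → mk⇔ (λ a → [ edgeˡ a , edgeʳ a ]′ (uncrossed a))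
      [ (λ { (_ , _ , refl , refl , a) → Adj⁺ left a })
      , (λ { (_ , _ , refl , refl , a) → Adj⁺ right a }) ]′
  }
  where
  open Cover κ

  cD : Copy (D [ ∂D ]) G (λ g → Left g × Right g)
  cD = copy-∘-sub left ∂D ∂ˡ⁺ ∂ˡ⁻

  cC : Copy (C [ ∂C ]) G (λ g → Left g × Right g)
  cC = copy-resp (λ (r , l) → l , r) (λ (l , r) → r , l) (copy-∘-sub right ∂C ∂ʳ⁺ ∂ʳ⁻)

  shared : ∀ x y → at left x ≡ at right y →
           ∃ λ b → x ≡ element ∂D b × y ≡ element ∂C (_≅_.to (copy-≅ cD cC) b)
  shared x y eq with index ∂D (∂ˡ⁻ (subst Right (sym eq) (sound right y)))
  ... | b , refl = b , refl , at-inj right (trans (sym eq) (sym (copy-factor-at cD cC id b)))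

  edgeˡ : ∀ {g h} → Adj G g h → Left g × Left h →
          (∃₂ λ x x′ → at left x ≡ g × at left x′ ≡ h × Adj D x x′) ⊎ _
  edgeˡ a (lg , lh) with complete left lg | complete left lh
  ... | x , refl | x′ , refl = inj₁ (x , x′ , refl , refl , Adj⁻ left a)

  edgeʳ : ∀ {g h} → Adj G g h → Right g × Right h →
          _ ⊎ (∃₂ λ y y′ → at right y ≡ g × at right y′ ≡ h × Adj C y y′)
  edgeʳ a (rg , rh) with complete right rg | complete right rh
  ... | y , refl | y′ , refl = inj₂ (y , y′ , refl , refl , Adj⁻ right a)

cover⇒sphere : ∀ {n D C ∂D ∂C} → IsDiskWithBoundary (suc (suc n)) D ∂D →
               IsDiskWithBoundary (suc (suc n)) C ∂C → Cover D C ∂D ∂C G → IsSphere (suc (suc n)) G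
cover⇒sphere d d′ κ = let φ , γ = cover⇒gluing κ in sphere₂₊ _ _ _ _ d d′ φ γ

sphere-≅ : ∀ {n} → X ≅ Y → IsSphere n X → IsSphere n Y
sphere-≅ φ (sphere₀ ψ) = sphere₀ (≅-trans (≅-sym φ) ψ)
sphere-≅ {Y = Y} φ (sphere₁ conn rims) = sphere₁ (connected-≅ (≅⇒copy φ) conn) λ y →
  sphere-≅ (≅-sym (rim-≅ (≅⇒copy (≅-sym φ)) y)) (rims _)
sphere-≅ φ (sphere₂₊ _ _ _ _ d d′ _ γ) =
  cover⇒sphere d d′ (cover-≅ (≅⇒copy (≅-sym φ)) (gluing⇒cover γ))

disk-≅ : ∀ {n} → X ≅ Y → IsDisk n X → IsDisk n Y
disk-≅ {X = X} {Y} φ (∂ , d) = transport d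
  where
  c : Copy Y X (λ _ → Unit)
  c = ≅⇒copy (≅-sym φ)

  ∂? : Decidable (λ y → at c y ∈ ∂)
  ∂? y = at c y ∈? ∂

  preimage : ∀ (P : Point X → Set) {x} → P x → ∃ λ y → P (at c y)
  preimage P Px = let y , eq = complete c tt in y , subst P (sym eq) Px

  transport : ∀ {n} → IsDiskWithBoundary n X ∂ → IsDisk n Y
  transport (disk₀ ψ) = ⊥ , disk₀ (≅-trans (≅-sym φ) ψ)
  -- The number of neighbours is the order of the rim, which `rim-≅` preserves.
  transport (disk₁ S v s ψ ends) = select ∂? , disk₁ S v s (≅-trans (≅-sym φ) ψ)
    λ y → mk⇔ (λ y∈ → trans (≅⇒order≡ (rim-≅ c y)) (Equivalence.to (ends _) (∈-select⁻ ∂? y∈)))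
              (λ eq → ∈-select⁺ ∂? (Equivalence.from (ends _)
                        (trans (sym (≅⇒order≡ (rim-≅ c y))) eq)))
  transport (disk₂₊ conn contr (b , b∈) (i , i∈) rim∂ rimᵢ s∂) =
    select ∂? , disk₂₊ (connected-≅ (≅⇒copy φ) conn) (relabel φ contr)
    (map₂ (∈-select⁺ ∂?) (preimage (_∈ ∂) b∈))
    (map₂ (λ y∈ → x∉p⇒x∈∁p (x∈∁p⇒x∉p y∈ ∘ ∈-select⁻ ∂?)) (preimage (_∈ ∁ ∂) i∈))
    (λ y y∈ → disk-≅ (≅-sym (rim-≅ c y)) (rim∂ _ (∈-select⁻ ∂? y∈)))
    (λ y y∈ → sphere-≅ (≅-sym (rim-≅ c y)) (rimᵢ _ (x∉p⇒x∈∁p (x∈∁p⇒x∉p y∈ ∘ ∈-select⁺ ∂?))))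
    (sphere-≅ (copy-≅ (copy-sub X ∂)
      (copy-resp proj₂ (tt ,_) (copy-∘-sub c (select ∂?) {_∈ ∂} (∈-select⁻ ∂?) (∈-select⁺ ∂?)))) s∂)

-- Circles

-- Its chains are the paths of `G - v`, written without relabelling the points.
Avoiding : (G : Graph) → Point G → Point G → Point G → Set
Avoiding G v x y = Adj G x y × x ≢ v × y ≢ v

connected-delete : ∀ {v a : Point G} → a ≢ v → (∀ {x} → x ≢ v → Star (Avoiding G v) a x) →
                   Connected (G - v)
connected-delete {G = G} {v} {a} a≢v reach with complete (copy-delete G v) a≢v
... | i , refl = connected-root {G = G - v} i λ j → lift (reach (sound (copy-delete G v) j))
  where
  lift : ∀ {i j} → Star (Avoiding G v) (at (copy-delete G v) i) (at (copy-delete G v) j) →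
         Star (Adj (G - v)) i j
  lift = go refl
    where
    -- The starting point is freed to a variable `x` so that the path can be matched on.
    go : ∀ {x i j} → at (copy-delete G v) i ≡ x → Star (Avoiding G v) x (at (copy-delete G v) j) →
         Star (Adj (G - v)) i j
    go {i = i} {j} eq ε = subst (Star (Adj (G - v)) i) (at-inj (copy-delete G v) eq) ε
    go refl ((a , _ , z≢v) ◅ path) with complete (copy-delete G v) z≢v
    ... | k , refl = Adj⁻ (copy-delete G v) a ◅ go refl path

opposite-neighbour : ∀ G {x y} → rim G x ≅ S⁰ → Adj G x y →
                     ∃ λ z → z ≢ y × Adj G x z × (∀ {w} → Adj G x w → w ≡ y ⊎ w ≡ z)
opposite-neighbour G {x} φ x~y with complete (copy-rim G x) x~y
... | i , refl with other-point φ i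
... | j , j≢i , only = at c j , j≢i ∘ at-inj c , sound c j , λ x~w → only′ (complete c x~w)
  where
  c = copy-rim G x

  only′ : ∀ {w} → (∃ λ k → at c k ≡ w) → w ≡ at c i ⊎ w ≡ at c j
  only′ (k , refl) = [ inj₁ ∘ cong (at c) , inj₂ ∘ cong (at c) ]′ (only k)

-- Walking round a circle from a neighbour a of v.  The points visited so far
-- form an arc, whose last point e is entered from pre and left towards nxt.

module Walk (S : Graph) (conn : Connected S) (rims : ∀ x → rim S x ≅ S⁰)
            (v a : Point S) (v~a : Adj S v a) where

  record Arc (p : Subset (order S)) (e pre nxt : Point S) : Set where
    field
      v∉p    : v ∉ p
      a∈p    : a ∈ p
      e∈p    : e ∈ p
      arc-T  : Con S (_∈ p)
      reach  : ∀ {x} → x ∈ p → Star (Avoiding S v) a x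
      -- By symmetry of adjacency, a point outside the arc and other than `v` can touch the arc only
      -- at `e`.
      closed : ∀ {x y} → x ∈ p → x ≢ e → Adj S x y → y ≡ v ⊎ y ∈ p
      behind : pre ≡ v × e ≡ a ⊎ pre ∈ p × e ≢ a
      e~nxt  : Adj S e nxt
      nxt≢   : nxt ≢ pre
      nxt∉p  : nxt ∉ p
      ends   : ∀ {y} → Adj S e y → y ≡ pre ⊎ y ≡ nxt

  -- When the walk is about to enter `v`, the arc together with `v` is closed under adjacency: `e`
  -- differs from `a`, so these are the two neighbours of `v`. Connectedness then makes it all of
  -- `S`.
  finish : ∀ {p e pre} → Arc p e pre v →
           Con S (_≢ v) × (∀ {x} → x ≢ v → Star (Avoiding S v) a x)
  finish {p} {e} {pre} arc = con-resp (λ { x∈ refl → v∉p x∈ }) all arc-T , reach ∘ all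
    where
    open Arc arc

    pre∈p : pre ∈ p × e ≢ a
    pre∈p = [ (λ (pre≡v , _) → contradiction (sym pre≡v) nxt≢) , id ]′ behind

    step : ∀ {x y} → x ≡ v ⊎ x ∈ p → Adj S x y → y ≡ v ⊎ y ∈ p
    step {y = y} (inj₁ refl) v~y with opposite-neighbour S {v} {a} (rims v) v~a
    ... | b , _ , _ , only with only {y} v~y | only {e} (Adj-sym S e~nxt)
    ... | inj₁ refl | _         = inj₂ a∈p
    ... | inj₂ _    | inj₁ e≡a  = contradiction e≡a (proj₂ pre∈p)
    ... | inj₂ refl | inj₂ refl = inj₂ e∈p
    step {x} (inj₂ x∈) x~y with x ≟ e
    ... | no x≢e   = closed x∈ x≢e x~y
    ... | yes refl = [ (λ { refl → inj₂ (proj₁ pre∈p) }) , inj₁ ]′ (ends x~y)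

    walk : ∀ {x y} → x ≡ v ⊎ x ∈ p → Star (Adj S) x y → y ≡ v ⊎ y ∈ p
    walk x∈ ε = x∈
    walk x∈ (x~y ◅ path) = walk (step x∈ x~y) path

    all : ∀ {x} → x ≢ v → x ∈ p
    all {x} x≢v = [ (λ x≡v → contradiction x≡v x≢v) , id ]′ (walk (inj₁ refl) (proj₂ conn v x))

  -- By `closed`, the only neighbour of `nxt` in the arc is `e`, so the rim of the added point is a
  -- single point.
  extend : ∀ {p e pre nxt} → Arc p e pre nxt → nxt ≢ v →
           ∃ λ nxt′ → Arc (p ∪ ⁅ nxt ⁆) nxt e nxt′
  extend {p} {e} {pre} {nxt} arc nxt≢v with opposite-neighbour S {nxt} {e} (rims nxt) (Adj-sym S (Arc.e~nxt arc))
  ... | nxt′ , nxt′≢e , nxt~nxt′ , only = nxt′ , record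
    { v∉p    = λ v∈ → [ v∉p , nxt≢v ∘ sym ]′ (split v∈)
    ; a∈p    = old a∈p
    ; e∈p    = new
    ; arc-T  = con-resp [ old , (λ { refl → new }) ]′ split
        (con-add arc-T nxt∉p
          (con-resp (λ { refl → e∈p , Adj-sym S e~nxt })
                    (λ (g∈ , nxt~g) → only-e g∈ nxt~g) (con-singleton e)))
    ; reach  = λ x∈ → [ reach , (λ { refl → reach e∈p ◅◅ (e~nxt , e≢v , nxt≢v) ◅ ε }) ]′ (split x∈)
    ; closed = closed′
    ; behind = inj₂ (old e∈p , λ { refl → nxt∉p a∈p })
    ; e~nxt  = nxt~nxt′
    ; nxt≢   = nxt′≢e
    ; nxt∉p  = λ ∈p′ → [ (λ ∈p → nxt′≢e (only-e ∈p nxt~nxt′)) , Adj⇒≢ S nxt~nxt′ ∘ sym ]′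
                       (split ∈p′)
    ; ends   = only
    }
    where
    open Arc arc

    old : ∀ {x} → x ∈ p → x ∈ p ∪ ⁅ nxt ⁆
    old = x∈p∪q⁺ ∘ inj₁

    new : nxt ∈ p ∪ ⁅ nxt ⁆
    new = x∈p∪q⁺ (inj₂ (x∈⁅x⁆ nxt))

    split : ∀ {x} → x ∈ p ∪ ⁅ nxt ⁆ → x ∈ p ⊎ x ≡ nxt
    split x∈ = [ inj₁ , inj₂ ∘ x∈⁅y⁆⇒x≡y nxt ]′ (x∈p∪q⁻ p ⁅ nxt ⁆ x∈)

    e≢v : e ≢ v
    e≢v refl = v∉p e∈p

    only-e : ∀ {x} → x ∈ p → Adj S nxt x → x ≡ e
    only-e {x} x∈ nxt~x with x ≟ e
    ... | yes x≡e = x≡e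
    ... | no  x≢e = absurd ([ nxt≢v , nxt∉p ]′ (closed x∈ x≢e (Adj-sym S nxt~x)))

    closed′ : ∀ {x y} → x ∈ p ∪ ⁅ nxt ⁆ → x ≢ nxt → Adj S x y → y ≡ v ⊎ y ∈ p ∪ ⁅ nxt ⁆
    closed′ {x} x∈′ x≢nxt x~y with split x∈′ | x ≟ e
    ... | inj₂ x≡nxt | _        = contradiction x≡nxt x≢nxt
    ... | inj₁ x∈    | no x≢e   = [ inj₁ , inj₂ ∘ old ]′ (closed x∈ x≢e x~y)
    ... | inj₁ x∈    | yes refl with ends x~y
    ...   | inj₂ refl = inj₂ new
    ...   | inj₁ refl = [ inj₁ ∘ proj₁ , inj₂ ∘ old ∘ proj₁ ]′ behind

  walk : ∀ {p e pre nxt} → Acc _⊃_ p → Arc p e pre nxt →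
         Con S (_≢ v) × (∀ {x} → x ≢ v → Star (Avoiding S v) a x)
  walk {p} {nxt = nxt} (acc rs) arc with nxt ≟ v
  ... | yes refl  = finish arc
  ... | no  nxt≢v = walk (rs ((x∈p∪q⁺ ∘ inj₁) , nxt , x∈p∪q⁺ (inj₂ (x∈⁅x⁆ nxt)) , Arc.nxt∉p arc))
                         (proj₂ (extend arc nxt≢v))

  start : ∃ λ nxt → Arc ⁅ a ⁆ a v nxt
  start with opposite-neighbour S {a} {v} (rims a) (Adj-sym S v~a)
  ... | nxt , nxt≢v , a~nxt , only = nxt , record
    { v∉p    = λ v∈ → Adj⇒≢ S v~a (x∈⁅y⁆⇒x≡y a v∈)
    ; a∈p    = x∈⁅x⁆ a
    ; e∈p    = x∈⁅x⁆ a
    ; arc-T  = con-resp (λ { refl → x∈⁅x⁆ a }) (x∈⁅y⁆⇒x≡y a) (con-singleton a)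
    ; reach  = λ x∈ → subst (Star (Avoiding S v) a) (sym (x∈⁅y⁆⇒x≡y a x∈)) ε
    ; closed = λ x∈ x≢a _ → contradiction (x∈⁅y⁆⇒x≡y a x∈) x≢a
    ; behind = inj₁ (refl , refl)
    ; e~nxt  = a~nxt
    ; nxt≢   = nxt≢v
    ; nxt∉p  = λ ∈a → Adj⇒≢ S a~nxt (sym (x∈⁅y⁆⇒x≡y a ∈a))
    ; ends   = only
    }

  punctured : Con S (_≢ v) × (∀ {x} → x ≢ v → Star (Avoiding S v) a x)
  punctured = walk (⊃-wellFounded _) (proj₂ start)

-- Uniform facts about disks, including punctured circles.

sphere₀⁻ : IsSphere 0 X → X ≅ S⁰
sphere₀⁻ (sphere₀ φ) = φ

disk₀⁻ : ∀ {∂} → IsDiskWithBoundary 0 X ∂ → X ≅ K₁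
disk₀⁻ (disk₀ φ) = φ

disk₀-boundary : ∀ {∂ x} → IsDiskWithBoundary 0 X ∂ → x ∉ ∂
disk₀-boundary (disk₀ _) = ∉⊥

-- Here `D` has dimension `suc n`. From dimension 2 on the fields are clauses of the definition;
-- 1-disks are defined as punctured circles, so for them the fields have to be derived.
record DiskFacts (n : ℕ) (D : Graph) (∂ : Subset (order D)) : Set where
  field
    connected    : Connected D
    contractible : Contractible D
    boundary     : Nonempty ∂
    rim-∂        : ∀ {x} → x ∈ ∂ → IsDisk n (rim D x)
    rim-int      : ∀ {x} → x ∉ ∂ → IsSphere n (rim D x)
    sphere-∂     : IsSphere n (D [ ∂ ])

-- With `rim-deleted-adj`, this reduces the rims of a punctured sphere to spheres, or punctured
-- spheres, one dimension lower.
rim-deleted : ∀ {v} (c : Copy X G (_≢ v)) {x} → ¬ Adj G (at c x) v →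
              rim X x ≅ rim G (at c x)
rim-deleted {G = G} c {x} x≁v = copy-≅
  (copy-resp proj₂ (λ a → (λ { refl → x≁v a }) , a) (copy-∘-rim c x)) (copy-rim G (at c x))

rim-deleted-adj : ∀ {v} (c : Copy X G (_≢ v)) {x i} → at (copy-rim G (at c x)) i ≡ v →
                  rim X x ≅ rim G (at c x) - i
rim-deleted-adj {G = G} c {x} {i} eq = copy-≅
  (copy-resp (λ (≢v , a) → a , λ e → ≢v (trans e eq)) (λ (a , ≢i) → (λ e → ≢i (trans e (sym eq))) , a)
    (copy-∘-rim c x))
  (copy-∘-delete (copy-rim G (at c x)) i)

point-of-S⁰ : X ≅ S⁰ → Point X
point-of-S⁰ φ = proj₁ (complete (≅⇒copy φ) {zero} tt)

sphere₀-delete : X ≅ S⁰ → ∀ v → X - v ≅ K₁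
sphere₀-delete {X = X} φ v with other-point φ v
... | w , w≢v , only with complete (copy-delete X v) w≢v
... | i , refl = one-point⇒K₁ i λ j → at-inj c
  ([ (λ eq → contradiction eq (sound c j)) , id ]′ (only (at c j)))
  where c = copy-delete X v

S⁰≇K₁ : X ≅ S⁰ → order X ≢ 1
S⁰≇K₁ φ eq with trans (sym (≅⇒order≡ φ)) eq
... | ()

-- Deleting `v` costs each neighbour of `v` one of its two neighbours and leaves the other rims
-- alone. So the points of degree 1 are the neighbours of `v`, and the boundary is the 0-sphere
-- `rim S v`.
module PuncturedCircle {S D : Graph} (conn : Connected S) (circle : ∀ x → rim S x ≅ S⁰)
                       {v : Point S} (c : Copy D S (_≢ v)) where

  a : Point S
  a = at (copy-rim S v) (point-of-S⁰ (circle v))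

  v~a : Adj S v a
  v~a = sound (copy-rim S v) (point-of-S⁰ (circle v))

  a≢v : a ≢ v
  a≢v eq = Adj⇒≢ S v~a (sym eq)

  walked : Con S (_≢ v) × (∀ {x} → x ≢ v → Star (Avoiding S v) a x)
  walked = Walk.punctured S conn circle v a v~a

  degree-1⁺ : ∀ {x} → Adj S (at c x) v → ∣ neighbours D x ∣ ≡ 1
  degree-1⁺ {x} x~v = let i , eq = complete (copy-rim S (at c x)) x~v in
    ≅⇒order≡ (≅-trans (rim-deleted-adj c {x} {i} eq) (sphere₀-delete (circle (at c x)) i))

  degree-1⁻ : ∀ {x} → ∣ neighbours D x ∣ ≡ 1 → Adj S (at c x) v
  degree-1⁻ {x} deg = decidable-stable (adj? S (at c x) v) λ x≁v →
    S⁰≇K₁ (≅-trans (rim-deleted c {x} x≁v) (circle (at c x))) deg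

  facts : ∀ {∂} → (∀ x → x ∈ ∂ ⇔ ∣ neighbours D x ∣ ≡ 1) → DiskFacts 0 D ∂
  facts {∂} ends = record
    { connected    = connected-≅ (≅⇒copy (copy-≅ (copy-delete S v) c))
                       (connected-delete {G = S} {v} {a} a≢v (proj₂ walked))
    ; contractible = con⇒contractible (proj₁ walked) c
    ; boundary     = let x , eq = complete c {a} a≢v in
                     x , ∂⁺ (subst (λ y → Adj S y v) (sym eq) (Adj-sym S v~a))
    ; rim-∂        = λ {x} x∈ → let w , only = Fin≡1 (Equivalence.to (ends x) x∈) in
                       ⊥ , disk₀ (one-point⇒K₁ w only)
    ; rim-int      = λ {x} x∉ → sphere₀ (≅-trans (rim-deleted c {x} (x∉ ∘ ∂⁺)) (circle (at c x)))
    ; sphere-∂     = sphere₀ (≅-trans (copy-≅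
        (copy-resp (λ (_ , a) → Adj-sym S a) (λ a → (λ { refl → Adj-irrefl S a }) , Adj-sym S a)
          (copy-∘-sub c ∂ {λ x → Adj S x v} ∂⁻ ∂⁺)) (copy-rim S v)) (circle v))
    }
    where
    ∂⁺ : ∀ {x} → Adj S (at c x) v → x ∈ ∂
    ∂⁺ {x} = Equivalence.from (ends x) ∘ degree-1⁺ {x}

    ∂⁻ : ∀ {x} → x ∈ ∂ → Adj S (at c x) v
    ∂⁻ {x} = degree-1⁻ {x} ∘ Equivalence.to (ends x)

disk-facts : ∀ {n D ∂} → IsDiskWithBoundary (suc n) D ∂ → DiskFacts n D ∂
disk-facts (disk₁ S v (sphere₁ conn rims) φ ends) =
  PuncturedCircle.facts conn (λ x → sphere₀⁻ (rims x)) (≅-along (copy-delete S v) (≅-sym φ)) ends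
disk-facts (disk₂₊ conn contr b _ rim∂ rimᵢ s) = record
  { connected = conn ; contractible = contr ; boundary = b ; rim-∂ = rim∂ _
  ; rim-int = rimᵢ _ ∘ x∉p⇒x∈∁p ; sphere-∂ = s }

disk⇒contractible : ∀ {n D} → IsDisk n D → Contractible D
disk⇒contractible {zero}  (_ , d) = relabel (≅-sym (disk₀⁻ d)) one-point
disk⇒contractible {suc n} (_ , d) = DiskFacts.contractible (disk-facts d)

-- Spheres are manifolds

-- The equation `x↦g` is a parameter because a boundary point of a gluing is reached from both
-- halves, and only one of its two descriptions can be definitional.
module _ {P : Point G → Set} (c : Copy X G P) {x g} (x↦g : at c x ≡ g) where

  private
    into : Copy (rim X x) G (λ h → P h × Adj G g h)
    into = subst (λ g → Copy (rim X x) G (λ h → P h × Adj G g h)) x↦g (copy-∘-rim c x)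

  rim-copy : Copy (rim X x) (rim G g) (P ∘ at (copy-rim G g))
  rim-copy = copy-resp proj₁ (λ {i} p → p , sound (copy-rim G g) i)
               (copy-factor into (copy-rim G g) proj₂)

  rim-copy-at : ∀ i → at (copy-rim G g) (at rim-copy i) ≡ at c (at (copy-rim X x) i)
  rim-copy-at i = trans (copy-factor-at into (copy-rim G g) proj₂ i) (into-at x↦g)
    where
    into-at : ∀ {g} (e : at c x ≡ g) →
              at (subst (λ g → Copy (rim X x) G (λ h → P h × Adj G g h)) e (copy-∘-rim c x)) i ≡
              at c (at (copy-rim X x) i)
    into-at refl = refl

-- Both sides are the joint rim of `x` and `y`, read once inside each rim.
rim-rim-≅ : ∀ G {x y i j} → at (copy-rim G x) i ≡ y → at (copy-rim G y) j ≡ x →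
            rim (rim G x) i ≅ rim (rim G y) j
rim-rim-≅ G {x} {y} {i} {j} i↦y j↦x = copy-≅
  (copy-resp (λ (x~g , i~g) → subst (λ z → Adj G z _) i↦y i~g , subst (λ z → Adj G z _) (sym j↦x) x~g)
             (λ (y~g , j~g) → subst (λ z → Adj G z _) j↦x j~g , subst (λ z → Adj G z _) (sym i↦y) y~g)
             (copy-∘-rim (copy-rim G x) i))
  (copy-∘-rim (copy-rim G y) j)

connected-gluing : ∀ {D C ∂D ∂C} → Cover D C ∂D ∂C G → Connected D → Connected C → Nonempty ∂D →
                   Connected G
connected-gluing {G = G} κ (_ , pathD) (_ , pathC) (b , b∈) = connected-root {G = G} (at left b) reach
  where
  open Cover κ

  reach : ∀ g → Star (Adj G) (at left b) g
  reach g with covering g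
  ... | inj₁ l with complete left l
  ...   | x , refl = gmap (at left) (Adj⁺ left) (pathD b x)
  reach g | inj₂ r with complete right r | complete right (∂ˡ⁺ b∈)
  ...   | y , refl | y₀ , eq = subst (λ h → Star (Adj G) h _) eq (gmap (at right) (Adj⁺ right) (pathC y₀ y))

-- By `uncrossed`, an edge can leave the left part only from a boundary point.
rim-interior : ∀ {D C ∂D ∂C} (κ : Cover D C ∂D ∂C G) {x} → x ∉ ∂D →
               rim D x ≅ rim G (at (Cover.left κ) x)
rim-interior {G = G} κ {x} x∉ = copy-≅
  (copy-resp proj₂ (λ x~g → [ proj₂ , (λ (r , _) → absurd (x∉ (∂ˡ⁻ r))) ]′ (uncrossed x~g) , x~g)
             (copy-∘-rim left x))
  (copy-rim G (at left x))
  where open Cover κ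

-- For `x` in `∂`, `E` is the rim of `x` in `∂`, labelled as in `rim D x`.
RimOf : ∀ {D} → Subset (order D) → (x : Point D) → Subset (order (rim D x)) → Set
RimOf {D} ∂ x E = (∀ {i} → i ∈ E → at (copy-rim D x) i ∈ ∂) × (∀ {i} → at (copy-rim D x) i ∈ ∂ → i ∈ E)

-- The rims from the two halves overlap in the boundary points adjacent to `at left x`; the `RimOf`
-- hypotheses make this overlap the boundary of both.
rim-cover : ∀ {D C ∂D ∂C} (κ : Cover D C ∂D ∂C G) (let open Cover κ) {x y E F} →
            at right y ≡ at left x → RimOf {D} ∂D x E → RimOf {C} ∂C y F →
            Cover (rim D x) (rim C y) E F (rim G (at left x))
rim-cover {G = G} κ {x} y↦ (E⁺ , E⁻) (F⁺ , F⁻) = record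
  { Left      = Left ∘ at r
  ; Right     = Right ∘ at r
  ; left      = rim-copy left refl
  ; right     = rim-copy right y↦
  ; covering  = covering ∘ at r
  ; ∂ˡ⁺       = λ {i} i∈ → subst Right (sym (rim-copy-at left refl i)) (∂ˡ⁺ (E⁺ i∈))
  ; ∂ˡ⁻       = λ {i} q → E⁻ (∂ˡ⁻ (subst Right (rim-copy-at left refl i) q))
  ; ∂ʳ⁺       = λ {i} i∈ → subst Left (sym (rim-copy-at right y↦ i)) (∂ʳ⁺ (F⁺ i∈))
  ; ∂ʳ⁻       = λ {i} q → F⁻ (∂ʳ⁻ (subst Left (rim-copy-at right y↦ i) q))
  ; uncrossed = uncrossed ∘ Adj⁺ r
  }
  where
  open Cover κ
  r = copy-rim G (at left x)

-- With empty boundaries the halves share no point, and `uncrossed` then forbids an edge between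
-- them.
glue₀ : ∀ {D C ∂D ∂C} → IsDiskWithBoundary 0 D ∂D → IsDiskWithBoundary 0 C ∂C →
        Cover D C ∂D ∂C G → G ≅ S⁰
glue₀ d d′ κ with K₁-unique (disk₀⁻ d) | K₁-unique (disk₀⁻ d′)
... | x , onlyˡ | y , onlyʳ = two-points⇒S⁰ (at left x) (at right y)
  (λ eq → disk₀-boundary d (∂ˡ⁻ (subst Right (sym eq) (sound right y))))
  (λ g → [ (λ l → let x′ , eq = complete left l in
                  inj₁ (trans (sym eq) (cong (at left) (onlyˡ x′))))
         , (λ r → let y′ , eq = complete right r in
                  inj₂ (trans (sym eq) (cong (at right) (onlyʳ y′)))) ]′ (covering g))
  (λ a → [ disk₀-boundary d′ ∘ ∂ʳ⁻ ∘ proj₂ , disk₀-boundary d ∘ ∂ˡ⁻ ∘ proj₁ ]′ (uncrossed a))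
  where open Cover κ

-- A rim at the seam of a gluing is a gluing one dimension lower, and locating the boundary of its
-- halves takes facts about lower-dimensional spheres and disks. Hence these seven statements
-- recurse together on the dimension.
sphere-rims : ∀ n {S} → IsSphere (suc n) S → Connected S × (∀ v → IsSphere n (rim S v))
gluing-rims : ∀ n {D C ∂D ∂C} → IsDiskWithBoundary (suc n) D ∂D → IsDiskWithBoundary (suc n) C ∂C →
              Cover D C ∂D ∂C G → Connected G × (∀ v → IsSphere n (rim G v))
gluing-rimˡ : ∀ n {D C ∂D ∂C} → IsDiskWithBoundary (suc n) D ∂D → IsDiskWithBoundary (suc n) C ∂C →
              (κ : Cover D C ∂D ∂C G) → ∀ x → IsSphere n (rim G (at (Cover.left κ) x))
-- From dimension 2 on this is the definition of a sphere; below, spheres are defined outright and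
-- the gluing must be shown to be one.
glue : ∀ n {D C ∂D ∂C} → IsDiskWithBoundary n D ∂D → IsDiskWithBoundary n C ∂C →
       Cover D C ∂D ∂C G → IsSphere n G
-- The definition of a disk gives `rim D x` some boundary `E` without relating it to `∂`.
rim-boundary : ∀ n {D ∂ x E} → IsDiskWithBoundary (suc n) D ∂ → x ∈ ∂ →
               IsDiskWithBoundary n (rim D x) E → RimOf {D} ∂ x E
-- The rim of a boundary point would be both a sphere and a disk one dimension lower; in dimension 0
-- the numbers of points differ.
sphere≇disk : ∀ n → IsSphere n X → ¬ IsDisk n X
-- By induction the copy contains the whole rim of each of its points, so it is closed under
-- adjacency and fills the connected sphere `Y`.
subsphere-full : ∀ n {P : Point Y → Set} → IsSphere n X → IsSphere n Y → Copy X Y P → ∀ y → P y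

sphere-rims zero    (sphere₁ conn rims)        = conn , rims
sphere-rims (suc n) (sphere₂₊ _ _ _ _ d d′ _ γ) = gluing-rims (suc n) d d′ (gluing⇒cover γ)

gluing-rims {G = G} n d d′ κ =
  connected-gluing κ (connected (disk-facts d)) (connected (disk-facts d′)) (boundary (disk-facts d)) ,
  λ g → [ (λ l → let x , eq = complete left l in
                 subst (IsSphere n ∘ rim G) eq (gluing-rimˡ n d d′ κ x))
        , (λ r → let y , eq = complete right r in
                 subst (IsSphere n ∘ rim G) eq (gluing-rimˡ n d′ d (cover-swap κ) y)) ]′ (covering g)
  where
  open Cover κ
  open DiskFacts

gluing-rimˡ n {∂D = ∂D} d d′ κ x with x ∈? ∂D
... | no  x∉ = sphere-≅ (rim-interior κ x∉) (DiskFacts.rim-int (disk-facts d) x∉)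
... | yes x∈ with complete (Cover.right κ) (Cover.∂ˡ⁺ κ x∈)
... | y , y↦ with Cover.∂ʳ⁻ κ (subst (Cover.Left κ) (sym y↦) (sound (Cover.left κ) x))
... | y∈ with DiskFacts.rim-∂ (disk-facts d) x∈ | DiskFacts.rim-∂ (disk-facts d′) y∈
... | E , e | F , f =
  glue n e f (rim-cover κ y↦ (rim-boundary n d x∈ e) (rim-boundary n d′ y∈ f))

glue zero          d d′ κ = sphere₀ (glue₀ d d′ κ)
glue (suc zero)    d d′ κ = let conn , rims = gluing-rims zero d d′ κ in sphere₁ conn rims
glue (suc (suc n)) d d′ κ = cover⇒sphere d d′ κ

-- Now `∂` is a 0-sphere, without edges, and `E` is empty: both inclusions are vacuous.
rim-boundary zero {D} {∂} {x} d x∈ e =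
  (λ i∈ → absurd (disk₀-boundary e i∈)) ,
  (λ {i} ∈∂ → absurd (nonadjacent x∈ ∈∂ (sound (copy-rim D x) i)))
  where
  nonadjacent : ∀ {x y} → x ∈ ∂ → y ∈ ∂ → ¬ Adj D x y
  nonadjacent x∈ y∈ x~y with index ∂ x∈ | index ∂ y∈
  ... | i , refl | j , refl = S⁰-nonadjacent (sphere₀⁻ (DiskFacts.sphere-∂ (disk-facts d))) {i} {j} x~y
rim-boundary (suc n) {D} {∂} {x} {E} d x∈ e = E⊆ , E⊇
  where
  r  = copy-rim D x
  fD = disk-facts d
  fE = disk-facts e

  -- Read at `i` the joint rim is a disk; read at `j`, inside the sphere around `at r i`, it is a
  -- sphere.
  E⊆ : ∀ {i} → i ∈ E → at r i ∈ ∂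
  E⊆ {i} i∈ = decidable-stable (at r i ∈? ∂) λ y∉ →
    let j , j↦x = complete (copy-rim D (at r i)) (Adj-sym D (sound r i)) in
    sphere≇disk n
      (sphere-≅ (rim-rim-≅ D {at r i} {x} {j} {i} j↦x refl)
                (proj₂ (sphere-rims n (DiskFacts.rim-int fD y∉)) j))
      (DiskFacts.rim-∂ fE i∈)

  x̂   = proj₁ (index ∂ x∈)
  x̂↦x = proj₂ (index ∂ x∈)

  Image : Point D → Set
  Image g = ∃ λ i → i ∈ E × at r i ≡ g

  -- `small` is the boundary sphere of `rim D x`, and `large` the rim of `x` in the sphere `∂`; both
  -- have dimension `n`, so the first fills the second.
  small : Copy (rim D x [ E ]) D (λ g → Adj D x g × Image g)
  small = copy-∘-sub r E {Image} (λ {i} i∈ → i , i∈ , refl)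
            (λ (i′ , i′∈ , eq) → subst (_∈ E) (at-inj r eq) i′∈)

  large : Copy (rim (D [ ∂ ]) x̂) D (λ g → g ∈ ∂ × Adj D x g)
  large = subst (λ z → Copy (rim (D [ ∂ ]) x̂) D (λ g → g ∈ ∂ × Adj D z g)) x̂↦x
            (copy-∘-rim (copy-sub D ∂) x̂)

  E⊇ : ∀ {i} → at r i ∈ ∂ → i ∈ E
  E⊇ {i} y∈ with complete large (y∈ , sound r i)
  ... | j , j↦ with subsphere-full n (DiskFacts.sphere-∂ fE)
                      (proj₂ (sphere-rims n (DiskFacts.sphere-∂ fD)) x̂)
                      (copy-factor small large (λ { (a , i′ , i′∈ , refl) → E⊆ i′∈ , a })) j
  ... | _ , i′ , i′∈ , eq = subst (_∈ E) (at-inj r (trans eq j↦)) i′∈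

sphere≇disk zero    s (_ , d) = S⁰≇K₁ (sphere₀⁻ s) (≅⇒order≡ (disk₀⁻ d))
sphere≇disk (suc n) s (_ , d) = let x , x∈ = DiskFacts.boundary (disk-facts d) in
  sphere≇disk n (proj₂ (sphere-rims n s) x) (DiskFacts.rim-∂ (disk-facts d) x∈)

subsphere-full zero {P} s s′ c y with point-of-S⁰ (sphere₀⁻ s)
... | a with other-point (sphere₀⁻ s) a | other-point (sphere₀⁻ s′) (at c a)
... | b , b≢a , _ | w , _ , only with only (at c b) | only y
... | inj₁ eq | _         = contradiction (at-inj c eq) b≢a
... | inj₂ _  | inj₁ refl = sound c a
... | inj₂ eq | inj₂ refl = subst P eq (sound c b)
subsphere-full {Y = Y} {X = X} (suc n) {P} s s′ c y = go (sound c x₀) (proj₂ (proj₁ (sphere-rims n s′)) (at c x₀) y)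
  where
  x₀ = proj₁ (proj₁ (sphere-rims n s))

  step : ∀ {g h} → P g → Adj Y g h → P h
  step Pg g~h with complete c Pg
  ... | x , refl with complete (copy-rim Y (at c x)) g~h
  ... | j , refl = subsphere-full n (proj₂ (sphere-rims n s) x) (proj₂ (sphere-rims n s′) (at c x))
                     (rim-copy c refl) j

  go : ∀ {g h} → P g → Star (Adj Y) g h → P h
  go Pg ε          = Pg
  go Pg (a ◅ path) = go (step Pg a) path

-- Cones over spheres are disks

addPoint-copy : ∀ G p → Copy G (addPoint G p) (_≢ zero)
at       (addPoint-copy G p) = suc
at-inj   (addPoint-copy G p) = suc-injective
at-adj   (addPoint-copy G p) _ _ = refl
sound    (addPoint-copy G p) _ = λ ()
complete (addPoint-copy G p) {zero}  ≢0 = contradiction refl ≢0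
complete (addPoint-copy G p) {suc g} _  = g , refl

lookup-⊤ : ∀ {n} (x : Fin n) → lookup ⊤ x ≡ true
lookup-⊤ x = []=⇒lookup (∈⊤ {x = x})

WithApex : (Point G → Set) → Fin (suc (order G)) → Set
WithApex P zero    = Unit
WithApex P (suc g) = P g

addPoint-mono : ∀ {P p q} (c : Copy X G P) → (∀ x → lookup q (at c x) ≡ lookup p x) →
                Copy (addPoint X p) (addPoint G q) (WithApex {G} P)
at       (addPoint-mono c q≡p) zero    = zero
at       (addPoint-mono c q≡p) (suc x) = suc (at c x)
at-inj   (addPoint-mono c q≡p) {zero}  {zero}  _  = refl
at-inj   (addPoint-mono c q≡p) {suc x} {suc y} eq = cong suc (at-inj c (suc-injective eq))
at-adj   (addPoint-mono c q≡p) zero    zero    = refl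
at-adj   (addPoint-mono c q≡p) zero    (suc y) = q≡p y
at-adj   (addPoint-mono c q≡p) (suc x) zero    = q≡p x
at-adj   (addPoint-mono c q≡p) (suc x) (suc y) = at-adj c x y
sound    (addPoint-mono c q≡p) zero    = tt
sound    (addPoint-mono c q≡p) (suc x) = sound c x
complete (addPoint-mono c q≡p) {zero}  _ = zero , refl
complete (addPoint-mono c q≡p) {suc g} Pg = let x , eq = complete c Pg in suc x , cong suc eq

cone-mono : ∀ {P} → Copy X G P → Copy (addPoint X ⊤) (addPoint G ⊤) (WithApex {G} P)
cone-mono c = addPoint-mono c (λ x → trans (lookup-⊤ (at c x)) (sym (lookup-⊤ x)))

rim-cone : ∀ K x → addPoint (rim K x) ⊤ ≅ rim (addPoint K ⊤) (suc x)
rim-cone K x = copy-≅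
  (copy-resp (λ { {zero} _ → lookup-⊤ x ; {suc _} a → a }) (λ { {zero} _ → tt ; {suc _} a → a })
             (cone-mono (copy-rim K x)))
  (copy-rim (addPoint K ⊤) (suc x))

-- The circle on four points. Its point `zero` is opposite the apex of a cone over `S⁰`, and
-- deleting it exhibits that cone as a 1-disk.
square : Graph
square = addPoint (addPoint S⁰ ⊤) (outside ∷ ⊤)

square-sphere : IsSphere 1 square
square-sphere = sphere₁
  (connected-root {G = square} zero λ
    { zero                   → ε
    ; (suc zero)             → _◅_ {j = suc (suc zero)} refl (refl ◅ ε)
    ; (suc (suc zero))       → refl ◅ ε
    ; (suc (suc (suc zero))) → refl ◅ ε })
  λ { zero                   → sphere₀ (two-points⇒S⁰ zero (suc zero) (λ ()) pair (λ ()))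
    ; (suc zero)             → sphere₀ (two-points⇒S⁰ zero (suc zero) (λ ()) pair (λ ()))
    ; (suc (suc zero))       → sphere₀ (two-points⇒S⁰ zero (suc zero) (λ ()) pair (λ ()))
    ; (suc (suc (suc zero))) → sphere₀ (two-points⇒S⁰ zero (suc zero) (λ ()) pair (λ ())) }
  where
  pair : (x : Fin 2) → x ≡ zero ⊎ x ≡ suc zero
  pair zero       = inj₁ refl
  pair (suc zero) = inj₂ refl

punctured-circle-disk : ∀ {D S} v → IsSphere 1 S → D ≅ S - v → IsDisk 1 D
punctured-circle-disk {D} {S} v s φ = select end? , disk₁ S v s φ λ x → mk⇔ (∈-select⁻ end?) (∈-select⁺ end?)
  where
  end? : Decidable (λ x → ∣ neighbours D x ∣ ≡ 1)
  end? x = ∣ neighbours D x ∣ ≟ⁿ 1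

-- Kept apart from `cone-disk` to record that the boundary is the base, as capping requires. The
-- apex is the only interior point, with rim `K`; rims of base points are cones one dimension lower.
cone-disk₂₊ : ∀ n {K} → IsSphere (suc n) K → IsDiskWithBoundary (suc (suc n)) (addPoint K ⊤) (outside ∷ ⊤)
cone-disk : ∀ n {K} → IsSphere n K → IsDisk (suc n) (addPoint K ⊤)

cone-disk zero (sphere₀ φ) = punctured-circle-disk zero square-sphere
  (copy-≅ (copy-resp proj₁ (_, tt)
                     (copy-∘ {P = λ _ → Unit} (addPoint-copy (addPoint S⁰ ⊤) (outside ∷ ⊤))
                       (copy-resp _ (λ { {zero} _ → tt ; {suc _} _ → tt }) (cone-mono (≅⇒copy φ)))))
          (copy-delete square zero))
cone-disk (suc n) s = outside ∷ ⊤ , cone-disk₂₊ n s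

cone-disk₂₊ n {K} s = disk₂₊
  (connected-root {G = addPoint K ⊤} zero λ { zero → ε ; (suc x) → lookup-⊤ x ◅ ε })
  (contractible-cone K)
  (suc (proj₁ (proj₁ (sphere-rims n s))) , there ∈⊤)
  (zero , here)
  (λ { (suc x) _ → disk-≅ (rim-cone K x) (cone-disk n (proj₂ (sphere-rims n s) x)) })
  (λ { zero _ → sphere-≅ (copy-≅ base (copy-rim (addPoint K ⊤) zero)) s
     ; (suc x) (there x∈) → contradiction ∈⊤ (x∈∁p⇒x∉p x∈) })
  (sphere-≅ (copy-≅ (copy-resp (λ { {zero} ≢0 → contradiction refl ≢0 ; {suc _} _ → there ∈⊤ })
                               (λ { (there _) () }) (addPoint-copy K ⊤))
                    (copy-sub (addPoint K ⊤) (outside ∷ ⊤))) s)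
  where
  base : Copy K (addPoint K ⊤) (Adj (addPoint K ⊤) zero)
  base = copy-resp (λ { {zero} ≢0 → contradiction refl ≢0 ; {suc x} _ → lookup-⊤ x })
                   (λ { {suc _} _ () }) (addPoint-copy K ⊤)

-- Puncturing

-- Provides an interior point of `S - v`. Inductively, it is found in the rim of a neighbour of `v`,
-- a lower sphere which contains `v`.
nonneighbour : ∀ n {S} → IsSphere n S → ∀ v → ∃ λ w → w ≢ v × ¬ Adj S v w
nonneighbour zero    (sphere₀ φ) v = let w , w≢v , _ = other-point φ v in w , w≢v , S⁰-nonadjacent φ
nonneighbour (suc n) {S} s v = found
  where
  sphere-point : ∀ n {K} → IsSphere n K → Point K
  sphere-point zero    (sphere₀ φ) = point-of-S⁰ φ
  sphere-point (suc n) k           = proj₁ (proj₁ (sphere-rims n k))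

  x = at (copy-rim S v) (sphere-point n (proj₂ (sphere-rims n s) v))
  c = copy-rim S x

  found : ∃ λ w → w ≢ v × ¬ Adj S v w
  found with complete c (Adj-sym S (sound (copy-rim S v) (sphere-point n (proj₂ (sphere-rims n s) v))))
  ... | i , i↦v = let j , j≢i , i≁j = nonneighbour n (proj₂ (sphere-rims n s) x) i in
    at c j , (λ eq → j≢i (at-inj c (trans eq (sym i↦v)))) ,
    λ a → i≁j (Adj⁻ c (subst (λ z → Adj S z (at c j)) (sym i↦v) a))

-- A passage through `v` enters and leaves by points of its rim, and a path inside the rim replaces
-- it.
reroute : ∀ {v} → Connected (rim G v) → ∀ {x y} → x ≢ v → y ≢ v → Star (Adj G) x y →
          Star (Avoiding G v) x y
reroute {G = G} {v} (_ , path) = go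
  where
  c = copy-rim G v

  round : ∀ {x w} → Adj G v x → Adj G v w → Star (Avoiding G v) x w
  round v~x v~w with complete c v~x | complete c v~w
  ... | i , refl | j , refl = gmap (at c)
    (λ {k} {l} a → Adj⁺ c a , Adj⇒≢ G (sound c k) ∘ sym , Adj⇒≢ G (sound c l) ∘ sym) (path i j)

  go : ∀ {x y} → x ≢ v → y ≢ v → Star (Adj G) x y → Star (Avoiding G v) x y
  go x≢v y≢v ε = ε
  go x≢v y≢v (_◅_ {j = z} a rest) with z ≟ v
  go x≢v y≢v (a ◅ rest)    | no z≢v   = (a , x≢v , z≢v) ◅ go z≢v y≢v rest
  go x≢v y≢v (a ◅ ε)       | yes refl = contradiction refl y≢v
  go x≢v y≢v (a ◅ b ◅ rest) | yes refl =
    round (Adj-sym G a) b ◅◅ go (Adj⇒≢ G b ∘ sym) y≢v rest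

-- Part (b) in one dimension, named to serve as the induction hypothesis.
Punctures : ℕ → Set
Punctures n = ∀ {S} → IsSphere n S → ∀ v → IsDisk n (S - v)

-- Only the rims of `S` enter, so this serves for the given sphere and for the capped disk alike.
con-move : ∀ {n S} → Punctures n → (∀ x → IsSphere n (rim S x)) →
           ∀ {u w} → Star (Adj S) u w → Con S (_≢ u) → Con S (_≢ w)
con-move {n} {S} puncture rims = go
  where
  link : ∀ {u w} → Adj S w u → Con S (λ g → g ≢ u × Adj S w g)
  link {u} {w} w~u with complete (copy-rim S w) w~u
  ... | i , refl = rim S w - i
    , copy-resp (λ (a , ≢u) → ≢u , a) (λ (≢u , a) → a , ≢u) (copy-∘-delete (copy-rim S w) i)
    , disk⇒contractible (puncture (rims w) i)

  step : ∀ {u w} → Adj S u w → Con S (_≢ u) → Con S (_≢ w)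
  step {u} {w} u~w con = con-resp
    [ proj₂ , (λ { refl → Adj⇒≢ S u~w }) ]′ split
    -- Deleting `w` gives `S` without `u` and `w`; then `u` is put back.
    (con-add (con-delete con (Adj⇒≢ S u~w ∘ sym) (link (Adj-sym S u~w)))
      (λ (u≢u , _) → u≢u refl)
      (con-resp (λ (≢w , u~g) → ((λ { refl → Adj-irrefl S u~g }) , ≢w) , u~g)
                (λ ((_ , ≢w) , u~g) → ≢w , u~g) (link u~w)))
    where
    split : ∀ {g} → g ≢ w → (g ≢ u × g ≢ w) ⊎ g ≡ u
    split {g} g≢w with g ≟ u
    ... | yes g≡u = inj₂ g≡u
    ... | no  g≢u = inj₁ (g≢u , g≢w)

  go : ∀ {u w} → Star (Adj S) u w → Con S (_≢ u) → Con S (_≢ w)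
  go ε          con = con
  go (a ◅ path) con = go path (step a con)

-- Presents the capped disk, with apex `zero`, as a gluing of `D` and a cone, so that `gluing-rims`
-- makes its rims spheres.
capped-cover : ∀ D ∂ → Cover D (addPoint (D [ ∂ ]) ⊤) ∂ (outside ∷ ⊤) (addPoint D ∂)
capped-cover D ∂ = record
  { Left      = _≢ zero
  ; Right     = WithApex {D} (_∈ ∂)
  ; left      = addPoint-copy D ∂
  ; right     = addPoint-mono (copy-sub D ∂)
                  (λ b → trans ([]=⇒lookup (element-∈ ∂ b)) (sym (lookup-⊤ b)))
  ; covering  = λ { zero → inj₂ tt ; (suc x) → inj₁ λ () }
  ; ∂ˡ⁺       = id
  ; ∂ˡ⁻       = id
  ; ∂ʳ⁺       = λ { (there _) () }
  ; ∂ʳ⁻       = λ { {zero} ≢0 → contradiction refl ≢0 ; {suc _} _ → there ∈⊤ }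
  ; uncrossed = λ { {zero}  {suc h} a → inj₂ (tt , lookup⇒[]= h ∂ a)
                  ; {suc g} {zero}  a → inj₂ (lookup⇒[]= g ∂ a , tt)
                  ; {suc g} {suc h} a → inj₁ ((λ ()) , λ ()) }
  }

-- The ambient graph H adds to S = D # C a cone point over C.  Deleting this
-- point from H - v leaves S - v, whereas contracting the points outside D onto
-- it leaves the capped disk addPoint D ∂D punctured at v.

con-uncap : ∀ {S D C ∂D ∂C} (κ : Cover D C ∂D ∂C S) → Contractible C → ∀ {i} → i ∉ ∂D →
            Con (addPoint D ∂D) (_≢ suc i) → Con S (_≢ at (Cover.left κ) i)
con-uncap {S} {D} {C} {∂D} κ contrC {i} i∉ con =
  con-resp (λ (≢v , _) → ≢v ∘ cong suc) (λ ≢v → ≢v ∘ suc-injective , λ ())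
    (con-factor (con-delete H-v (λ ()) rim-apex) (addPoint-copy S p) proj₂)
  where
  open Cover κ
  v  = at left i
  R? = copy-dec right
  p  = select R?
  H  = addPoint S p

  capped : Copy (addPoint D ∂D) H (WithApex {S} Left)
  capped = addPoint-mono left λ x → ⇔⇒≡
    (λ e → []=⇒lookup (∂ˡ⁻ (∈-select⁻ R? (lookup⇒[]= (at left x) p e))))
    (λ e → []=⇒lookup (∈-select⁺ R? (∂ˡ⁺ (lookup⇒[]= x ∂D e))))

  apex~ : ∀ {g} → Right g → Adj H zero (suc g)
  apex~ r = []=⇒lookup (∈-select⁺ R? r)

  capped-v : Con H (λ h → WithApex {S} Left h × h ≢ suc v)
  capped-v = con-∘ {P = _≢ suc v} capped
    (con-resp (λ ≢i eq → ≢i (at-inj capped eq)) (λ ≢v eq → ≢v (cong (at capped) eq)) con)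

  H-v : Con H (_≢ suc v)
  -- A point outside `Left` has all its neighbours in `S` in `Right`, hence is dominated by the
  -- apex.
  H-v = con-dominated capped-v proj₂ (λ h → ¬? (h ≟ suc v)) zero (tt , λ ()) λ
    { {zero}  _  ¬P → contradiction (tt , λ ()) ¬P
    ; {suc g} ≢v ¬P → [ (λ l → contradiction (l , ≢v) ¬P) , apex~ ]′ (covering g)
                    , λ { {zero}  _ _ ≢0 → contradiction refl ≢0
                        ; {suc h} _ a _  → [ (λ (l , _) → contradiction (l , ≢v) ¬P)
                                           , apex~ ∘ proj₂ ]′ (uncrossed a) } }

  rim-apex : Con H (λ h → h ≢ suc v × Adj H zero h)
  -- As `v` is interior to `D` it lies outside `C`, so the rim of the apex is all of `C`.
  rim-apex = C
    , copy-resp (λ (_ , a) → (λ { refl → i∉ (∂ˡ⁻ (∈-select⁻ R? (lookup⇒[]= v p a))) }) , a)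
                (λ { {suc _} (_ , a) → (λ ()) , a })
        (copy-∘ {P = Adj H zero} (addPoint-copy S p)
          (copy-resp apex~ (λ {g} a → ∈-select⁻ R? (lookup⇒[]= g p a)) right))
    , contrC

-- From the inside out: the puncture of the capped disk moves from the apex to an interior point of
-- `D`, the cap is exchanged for `C`, and the puncture moves within `S` to `v`.
con-puncture : ∀ n {S} → Punctures (suc n) → IsSphere (suc (suc n)) S → ∀ v → Con S (_≢ v)
con-puncture n {S} puncture s@(sphere₂₊ D C ∂D ∂C d@(disk₂₊ _ contrD _ (i , i∈) _ _ s∂) d′ _ γ) v =
  con-move puncture (proj₂ (sphere-rims (suc n) s)) (proj₂ (proj₁ (sphere-rims (suc n) s)) _ v)
    (con-uncap κ (disk⇒contractible (_ , d′)) (x∈∁p⇒x∉p i∈)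
      (con-move {S = addPoint D ∂D} puncture rims (path zero (suc i))
        (D , addPoint-copy D ∂D , contrD)))
  where
  κ = gluing⇒cover γ

  M-rims = gluing-rims (suc n) d (cone-disk₂₊ n s∂) (capped-cover D ∂D)
  path   = proj₂ (proj₁ M-rims)
  rims   = proj₂ M-rims

-- The boundary of `S - v` is the rim of `v`, a sphere by part (a); the rims of its points are
-- punctured spheres one dimension lower.
puncture : ∀ n → Punctures n
puncture zero          (sphere₀ φ) v = ⊥ , disk₀ (sphere₀-delete φ v)
puncture (suc zero)    s v = punctured-circle-disk v s ≅-refl
puncture (suc (suc n)) {S} s v = select ∂? , disk₂₊
  -- From dimension 2 on the rim of `v` is connected, so paths can be led round `v`; on a circle the
  -- rim is two isolated points, which is why it was walked.
  (connected-delete {G = S} {v} {a} a≢v λ {x} x≢v →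
    reroute {G = S} (proj₁ (sphere-rims n (rims v))) a≢v x≢v (path a x))
  (con⇒contractible (con-puncture n (puncture (suc n)) s v) c)
  (let i , eq = complete c a≢v in i , ∈-select⁺ ∂? (subst (Adj S v) (sym eq) v~a))
  (let w , w≢v , v≁w = nonneighbour (suc (suc n)) s v
       i , eq = complete c w≢v in
   i , x∉p⇒x∈∁p λ i∈ → v≁w (subst (Adj S v) eq (∈-select⁻ ∂? i∈)))
  (λ x x∈ → let i , eq = complete (copy-rim S (at c x)) (Adj-sym S (∈-select⁻ ∂? x∈)) in
    disk-≅ (≅-sym (rim-deleted-adj c {x} {i} eq)) (puncture (suc n) (rims (at c x)) i))
  (λ x x∈ → sphere-≅
    (≅-sym (rim-deleted c {x} (λ a → x∈∁p⇒x∉p x∈ (∈-select⁺ ∂? (Adj-sym S a))))) (rims (at c x)))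
  (sphere-≅ (copy-≅ (copy-rim S v)
    (copy-resp proj₂ (λ a → Adj⇒≢ S a ∘ sym , a)
      (copy-∘-sub c (select ∂?) {Adj S v} (∈-select⁻ ∂?) (∈-select⁺ ∂?)))) (rims v))
  where
  c    = copy-delete S v
  path = proj₂ (proj₁ (sphere-rims (suc n) s))
  rims = proj₂ (sphere-rims (suc n) s)

  ∂? : Decidable (λ i → Adj S v (at c i))
  ∂? i = adj? S v (at c i)

  a = at (copy-rim S v) (proj₁ (proj₁ (sphere-rims n (rims v))))

  v~a : Adj S v a
  v~a = sound (copy-rim S v) _

  a≢v : a ≢ v
  a≢v = Adj⇒≢ S v~a ∘ sym

lemma4p2 : (n : ℕ) → 1 ≤ n →
    ((S : Graph) → IsSphere n S → IsManifold n S) ×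
    ((S : Graph) → IsSphere n S → (v : Point S) → IsDisk n (S - v))
lemma4p2 (suc n) _ =
  (λ S s → let conn , rims = sphere-rims n s in manifold conn rims) ,
  (λ S s v → puncture (suc n) s v)
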